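{- Let $G$ be a connected bipartite cubic graph of order $n$. Then $\rho(G) \leq \frac{n}{3}$.
   Context: All graphs are finite and simple. A cubic graph is a $3$-regular graph. A subgraph $H$ of $G$ is induced if for all $u,v\in V(H)$, $uv\in E(H)$ iff $uv\in E(G)$. An induced path decomposition of $G$ is a set of pairwise vertex-disjoint paths covering all vertices of $G$, each of which is an induced subgraph of $G$. An IPD of $G$ is an induced path decomposition in which every path has order (number of vertices) at least $2$. $\rho(G)$ denotes the smallest number of paths in an IPD of $G$. -}

module Defs where

open import Data.Nat using (ℕ; suc; _≤_; _*_)
open import Data.Fin using (Fin; toℕ)
open import Data.Bool using (Bool; true; false)
open import Data.List using (List; []; _∷_; length; lookup; concat; allFin; filter)
open import Data.List.Relation.Binary.Permutation.Propositional using (_↭_)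
open import Data.List.Relation.Unary.All using (All)
open import Data.Product using (Σ; _×_; ∃)
open import Data.Sum using (_⊎_)
open import Function.Bundles using (_⇔_)
open import Relation.Binary.PropositionalEquality using (_≡_; _≢_)
open import Relation.Nullary.Decidable using (Dec)
open import Data.Bool.Properties using (_≟_)

record Graph (n : ℕ) : Set where
  field
    adj     : Fin n → Fin n → Bool
    symm    : ∀ u v → adj u v ≡ adj v u
    irrefl  : ∀ v → adj v v ≡ false
open Graph public

module _ {n : ℕ} (G : Graph n) where

  Adj : Fin n → Fin n → Set
  Adj u v = adj G u v ≡ true

  degree : Fin n → ℕ
  degree v = length (filter (λ u → adj G v u ≟ true) (allFin n))

  Cubic : Set
  Cubic = ∀ v → degree v ≡ 3

  Bipartite : Set
  Bipartite = Σ (Fin n → Bool) λ c → ∀ u v → Adj u v → c u ≢ c v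

  data Walk : Fin n → Fin n → Set where
    here : ∀ {u} → Walk u u
    step : ∀ {u w v} → Adj u w → Walk w v → Walk u v

  Connected : Set
  Connected = ∀ u v → Walk u v

  -- a list of vertices p = p₀ … p_{k-1} spans an induced path (in this order):
  -- p_i p_j is an edge of G iff |i - j| = 1.
  -- (Distinctness of the vertices is enforced globally in IPD below.)
  InducedPath : List (Fin n) → Set
  InducedPath p = ∀ (i j : Fin (length p)) →
    Adj (lookup p i) (lookup p j) ⇔ (toℕ j ≡ suc (toℕ i) ⊎ toℕ i ≡ suc (toℕ j))

  IsIPD : List (List (Fin n)) → Set
  IsIPD ps = All (λ p → InducedPath p × 2 ≤ length p) ps × (concat ps ↭ allFin n)

{-# OPTIONS --safe #-}

-- Delete a perfect matching that meets every 4-cycle: what remains is a 2-factor whose cycles have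
-- even length at least 6. A cycle of length k is cut into ⌊k/3⌋ consecutive paths of order 3, one of
-- them (k ≡ 1 mod 3) or two of them (k ≡ 2 mod 3) lengthened to order 4. Paths of order 3 are induced
-- by bipartiteness, and a path of order 4 is induced unless its ends are matched. As no vertex
-- has two matching edges, the paths of order 4 can be placed so as to avoid this.
--
-- To find the matching, contract a maximal family of disjoint 4-cycles, each to a single edge. The
-- result is a cubic bipartite multigraph, a perfect matching of which lifts to one of G that meets
-- the family. A 4-cycle Q still missed shares an edge with a member S of the family along which
-- the matching alternates; switching on S makes it meet Q, and misses no new 4-cycle.
module Submission where

open import Defs
open import Data.Bool using (Bool; true; false; if_then_else_; _∧_; not)
import Data.Bool.Properties as Bool
open import Data.Empty using (⊥; ⊥-elim)
open import Data.Fin using (Fin; zero; suc; toℕ)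
open import Data.Fin.Permutation as Perm using (Permutation′; _⟨$⟩ʳ_; _⟨$⟩ˡ_; _∘ₚ_)
import Data.Fin.Permutation.Components as PC
import Data.Fin.Properties as Fin
open import Data.List
  using (List; []; _∷_; _++_; length; lookup; allFin; filter; concat; applyUpTo; cartesianProduct)
open import Data.List.Membership.Propositional using (_∈_; _∉_)
open import Data.List.Membership.Propositional.Properties
  using (∈-allFin; ∈-applyUpTo⁺; ∈-applyUpTo⁻; ∈-++⁺ˡ; ∈-++⁺ʳ; ∈-++⁻; ∈-filter⁺; ∈-filter⁻; ∈-cartesianProduct⁺)
open import Data.List.Membership.Propositional.Properties.WithK using (unique∧set⇒bag)
open import Data.List.Properties using (length-++; length-tabulate; concat-++)
open import Data.List.Relation.Binary.BagAndSetEquality using (∼bag⇒↭)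
open import Data.List.Relation.Binary.Permutation.Propositional using (_↭_)
open import Data.List.Relation.Binary.Permutation.Propositional.Properties using (↭-length)
open import Data.List.Relation.Unary.All as All using (All; []; _∷_)
import Data.List.Relation.Unary.All.Properties as All
open import Data.List.Relation.Unary.AllPairs using ([]; _∷_)
open import Data.List.Relation.Unary.Any using (here; there)
open import Data.List.Relation.Unary.Unique.Propositional using (Unique)
import Data.List.Relation.Unary.Unique.Propositional.Properties as Unique
open import Data.Nat using (ℕ; zero; suc; _+_; _*_; _≤_; _<_; z≤n; s≤s; z<s; _<?_)
import Data.Nat.Properties as ℕ
open import Data.Product using (Σ; ∃; _×_; _,_; proj₁; proj₂)
open import Data.Sum using (_⊎_; inj₁; inj₂)
open import Function using (_∘_; id; _⇔_; mk⇔)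
open import Relation.Binary.PropositionalEquality
open import Relation.Nullary
  using (Dec; ¬_; yes; no; does; contradiction; _×-dec_; _⊎-dec_; ¬?; decidable-stable)
open import Algebra.Properties.CommutativeMonoid.Sum ℕ.+-0-commutativeMonoid
  using (sum; sum-cong-≗; ∑-comm; sum-permute)

-- The obstacle to cutting is a cycle of length 4: a path of order 4 in it has adjacent ends, and
-- there is no room for two pieces of order 3. Contraction forces a matching to meet a square
-- because each contracted vertex stands for two opposite vertices of it and its matching edge uses
-- up only one of them; the two left over, one on each side, are adjacent and get matched inside the
-- square. Overlapping squares cannot be contracted together, hence the disjoint family and the
-- switches.
--
-- One matching theorem serves twice, for weights with constant line sum 3 on the contraction and 2
-- on the complement of the matching. The second use splits the 2-factor into two matchings;
-- together with the colour classes they give a permutation `π` running around every cycle, so that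
-- cycles become orbits.

-- Finite sums and transpositions

sum-mono-≤ : ∀ {n} {f g : Fin n → ℕ} → (∀ i → f i ≤ g i) → sum f ≤ sum g
sum-mono-≤ {zero}  _ = z≤n
sum-mono-≤ {suc n} h = ℕ.+-mono-≤ (h zero) (sum-mono-≤ (h ∘ suc))

sum-mono-< : ∀ {n} {f g : Fin n → ℕ} → (∀ i → f i ≤ g i) → (i : Fin n) → f i < g i → sum f < sum g
sum-mono-< h zero    lt = ℕ.+-mono-<-≤ lt (sum-mono-≤ (h ∘ suc))
sum-mono-< h (suc i) lt = ℕ.+-mono-≤-< (h zero) (sum-mono-< (h ∘ suc) i lt)

sum-zero : ∀ {n} {f : Fin n → ℕ} → (∀ i → f i ≡ 0) → sum f ≡ 0
sum-zero {zero}  _ = refl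
sum-zero {suc n} h = cong₂ _+_ (h zero) (sum-zero (h ∘ suc))

sum-single : ∀ {n} {f : Fin n → ℕ} i → (∀ j → j ≢ i → f j ≡ 0) → sum f ≡ f i
sum-single {f = f} zero h =
  trans (cong (f zero +_) (sum-zero λ j → h (suc j) λ ())) (ℕ.+-identityʳ _)
sum-single (suc i) h =
  cong₂ _+_ (h zero λ ()) (sum-single i λ j j≢i → h (suc j) (j≢i ∘ Fin.suc-injective))

sum-remove-at : ∀ {n} (f : Fin n → ℕ) i →
  sum f ≡ f i + sum (λ j → if does (j Fin.≟ i) then 0 else f j)
sum-remove-at f zero    = refl
sum-remove-at f (suc i) = begin
  f zero + sum (f ∘ suc)          ≡⟨ cong (f zero +_) (sum-remove-at (f ∘ suc) i) ⟩
  f zero + (f (suc i) + s)        ≡⟨ ℕ.+-assoc (f zero) (f (suc i)) s ⟨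
  f zero + f (suc i) + s          ≡⟨ cong (_+ s) (ℕ.+-comm (f zero) (f (suc i))) ⟩
  f (suc i) + f zero + s          ≡⟨ ℕ.+-assoc (f (suc i)) (f zero) s ⟩
  f (suc i) + (f zero + s)        ∎
  where
  open ≡-Reasoning
  s = sum (λ j → if does (j Fin.≟ i) then 0 else f (suc j))

sum-pair : ∀ {n} {f : Fin n → ℕ} {i j} → i ≢ j → (∀ l → l ≢ i → l ≢ j → f l ≡ 0) →
  sum f ≡ f i + f j
sum-pair {f = f} {i} {j} i≢j h = begin
  sum f                ≡⟨ sum-remove-at f i ⟩
  f i + sum g          ≡⟨ cong (f i +_) (sum-single j g-zero) ⟩
  f i + g j            ≡⟨ cong (f i +_) gj ⟩
  f i + f j            ∎
  where
  open ≡-Reasoning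
  g : Fin _ → ℕ
  g l = if does (l Fin.≟ i) then 0 else f l
  g-zero : ∀ l → l ≢ j → g l ≡ 0
  g-zero l l≢j with l Fin.≟ i
  ... | yes _   = refl
  ... | no l≢i = h l l≢i l≢j
  gj : g j ≡ f j
  gj with j Fin.≟ i
  ... | yes e = contradiction (sym e) i≢j
  ... | no _  = refl

sum-triple : ∀ {n} {f : Fin n → ℕ} {i j k} → i ≢ j → i ≢ k → j ≢ k →
  (∀ l → l ≢ i → l ≢ j → l ≢ k → f l ≡ 0) → sum f ≡ f i + (f j + f k)
sum-triple {f = f} {i} {j} {k} i≢j i≢k j≢k h = begin
  sum f                ≡⟨ sum-remove-at f i ⟩
  f i + sum g          ≡⟨ cong (f i +_) (sum-pair j≢k g-zero) ⟩
  f i + (g j + g k)    ≡⟨ cong (f i +_) (cong₂ _+_ (g-other (i≢j ∘ sym)) (g-other (i≢k ∘ sym))) ⟩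
  f i + (f j + f k)    ∎
  where
  open ≡-Reasoning
  g : Fin _ → ℕ
  g l = if does (l Fin.≟ i) then 0 else f l
  g-zero : ∀ l → l ≢ j → l ≢ k → g l ≡ 0
  g-zero l l≢j l≢k with l Fin.≟ i
  ... | yes _  = refl
  ... | no l≢i = h l l≢i l≢j l≢k
  g-other : ∀ {l} → l ≢ i → g l ≡ f l
  g-other {l} l≢i with l Fin.≟ i
  ... | yes e = contradiction e l≢i
  ... | no _  = refl

sum-positive⁻ : ∀ {n} {f : Fin n → ℕ} → 0 < sum f → ∃ λ i → 0 < f i
sum-positive⁻ {suc n} {f} lt with 0 <? f zero
... | yes p = zero , p
... | no ¬p with i , q ← sum-positive⁻ {n} {f ∘ suc}
                 (subst (λ a → 0 < a + sum (f ∘ suc)) (ℕ.n≤0⇒n≡0 (ℕ.≮⇒≥ ¬p)) lt) = suc i , q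

sum-if : ∀ {n} (b : Bool) (f : Fin n → ℕ) →
  (if b then sum f else 0) ≡ sum (λ i → if b then f i else 0)
sum-if true  f = refl
sum-if {n} false f = sym (sum-zero {n} λ _ → refl)

unique-length≤ : ∀ {n} {xs : List (Fin n)} → Unique xs → length xs ≤ n
unique-length≤ {n} {xs} u = Fin.injective⇒≤ {f = lookup xs} (lookup-inj u)
  where
  lookup∉ : ∀ {x : Fin n} {ys} → All (x ≢_) ys → ∀ i → x ≢ lookup ys i
  lookup∉ (p ∷ _)  zero    = p
  lookup∉ (_ ∷ ps) (suc i) = lookup∉ ps i
  lookup-inj : ∀ {ys : List (Fin n)} → Unique ys → ∀ {i j} → lookup ys i ≡ lookup ys j → i ≡ j
  lookup-inj (p ∷ u) {zero}  {zero}  _ = refl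
  lookup-inj (p ∷ u) {zero}  {suc j} e = contradiction e (lookup∉ p j)
  lookup-inj (p ∷ u) {suc i} {zero}  e = contradiction (sym e) (lookup∉ p i)
  lookup-inj (p ∷ u) {suc i} {suc j} e = cong suc (lookup-inj u e)

transpose-left : ∀ {n} (i j : Fin n) → PC.transpose i j i ≡ j
transpose-left i j with i Fin.≟ i
... | yes _ = refl
... | no ne = contradiction refl ne

transpose-right : ∀ {n} (i j : Fin n) → PC.transpose i j j ≡ i
transpose-right i j with j Fin.≟ i
... | yes e = e
... | no _ with j Fin.≟ j
...   | yes _ = refl
...   | no ne = contradiction refl ne

transpose-other : ∀ {n} {i j k : Fin n} → k ≢ i → k ≢ j → PC.transpose i j k ≡ k
transpose-other {i = i} {j} {k} k≢i k≢j with k Fin.≟ i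
... | yes e = contradiction e k≢i
... | no _ with k Fin.≟ j
...   | yes e = contradiction e k≢j
...   | no _  = refl

-- Perfect matchings of regular bipartite multigraphs

-- A permutation is repaired one row at a time. The list grown by Chain consists of the rows from
-- which x₀ can be reached by arcs z → w with W z (σ w) > 0. If it is closed under such arcs
-- but meets no arc leaving x₀, the columns σ(L) are supported on the rows L ∖ {x₀}, against the
-- constancy of the line sums.
module PositiveDiagonal {n : ℕ} (W : Fin n → Fin n → ℕ) (k : ℕ)
  (rows : ∀ x → sum (W x) ≡ suc k) (cols : ∀ y → sum (λ x → W x y) ≡ suc k) where

  open import Data.List.Membership.DecPropositional (Fin._≟_ {n}) using (_∈?_)

  module _ (σ : Permutation′ n) (x₀ : Fin n) where

    data Chain : List (Fin n) → Set where
      base : Chain (x₀ ∷ [])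
      grow : ∀ {L z w} → Chain L → w ∈ L → z ∉ L → 0 < W z (σ ⟨$⟩ʳ w) → Chain (z ∷ L)

    -- Rows repaired earlier stay repaired under either alternative, while nothing is demanded of
    -- the rows still to come.
    Preserves : Permutation′ n → Set
    Preserves τ = ∀ x → x ≢ x₀ → 0 < W x (τ ⟨$⟩ʳ x) ⊎ τ ⟨$⟩ʳ x ≡ σ ⟨$⟩ʳ x

    x₀∈ : ∀ {L} → Chain L → x₀ ∈ L
    x₀∈ base           = here refl
    x₀∈ (grow c _ _ _) = there (x₀∈ c)

    chain-unique : ∀ {L} → Chain L → Unique L
    chain-unique base              = [] ∷ []
    chain-unique (grow c _ z∉L _) = All.¬Any⇒All¬ _ z∉L ∷ chain-unique c

    -- Along the arcs from `z` to `x₀` every row takes the column of its successor, and `x₀` takes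
    -- the column of `z`. That `τ` agrees with `σ` off `L` is what the induction lives on: a new row
    -- `z` still has its old column, so one transposition hands it to `x₀` and passes `σ w` to `z`.
    rotate : ∀ {L z} → Chain L → z ∈ L → ∃ λ τ →
      τ ⟨$⟩ʳ x₀ ≡ σ ⟨$⟩ʳ z × Preserves τ × (∀ x → x ∉ L → τ ⟨$⟩ʳ x ≡ σ ⟨$⟩ʳ x)
    rotate base (here refl) = σ , refl , (λ _ _ → inj₂ refl) , λ _ _ → refl
    rotate (grow c w∈ z∉ p) (there z∈) with τ , e , pres , fix ← rotate c z∈ =
      τ , e , pres , λ x x∉ → fix x (x∉ ∘ there)
    rotate {z ∷ L} (grow {w = w} c w∈ z∉ p) (here refl) with τ , e , pres , fix ← rotate c w∈ =
      τ′ , trans at-x₀ (fix z z∉) , pres′ , fix′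
      where
      τ′ : Permutation′ n
      τ′ = Perm.transpose x₀ z ∘ₚ τ
      at-x₀ : τ′ ⟨$⟩ʳ x₀ ≡ τ ⟨$⟩ʳ z
      at-x₀ = cong (τ ⟨$⟩ʳ_) (transpose-left x₀ z)
      at-z : τ′ ⟨$⟩ʳ z ≡ σ ⟨$⟩ʳ w
      at-z = trans (cong (τ ⟨$⟩ʳ_) (transpose-right x₀ z)) e
      elsewhere : ∀ x → x ≢ x₀ → x ≢ z → τ′ ⟨$⟩ʳ x ≡ τ ⟨$⟩ʳ x
      elsewhere x a b = cong (τ ⟨$⟩ʳ_) (transpose-other a b)
      pres′ : Preserves τ′
      pres′ x x≢x₀ with x Fin.≟ z
      ... | yes refl = inj₁ (subst (λ y → 0 < W z y) (sym at-z) p)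
      ... | no x≢z = subst (λ y → 0 < W x y ⊎ y ≡ σ ⟨$⟩ʳ x) (sym (elsewhere x x≢x₀ x≢z)) (pres x x≢x₀)
      fix′ : ∀ x → x ∉ z ∷ L → τ′ ⟨$⟩ʳ x ≡ σ ⟨$⟩ʳ x
      fix′ x x∉ = trans (elsewhere x (λ { refl → x∉ (there (x₀∈ c)) }) (x∉ ∘ here)) (fix x (x∉ ∘ there))

    closed-absurd : ∀ {L} → Chain L →
      (∀ {w} → w ∈ L → ¬ (0 < W x₀ (σ ⟨$⟩ʳ w))) →
      (∀ {z w} → z ∉ L → w ∈ L → ¬ (0 < W z (σ ⟨$⟩ʳ w))) → ⊥
    closed-absurd {L} c noLoop noArc = ℕ.<-irrefl (sym total) (sum-mono-< bound x₀ strict)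
      where
      Col : Fin n → Fin n → ℕ
      Col y z = if does (z ∈? L) then W y (σ ⟨$⟩ʳ z) else 0
      capacity : Fin n → ℕ
      capacity z = if does (z ∈? L) then suc k else 0
      total : sum capacity ≡ sum (λ y → sum (Col y))
      total = begin
        sum capacity
          ≡⟨ sum-cong-≗ (λ z → cong (if does (z ∈? L) then_else 0) (sym (cols (σ ⟨$⟩ʳ z)))) ⟩
        sum (λ z → if does (z ∈? L) then sum (λ y → W y (σ ⟨$⟩ʳ z)) else 0)
          ≡⟨ sum-cong-≗ (λ z → sum-if (does (z ∈? L)) (λ y → W y (σ ⟨$⟩ʳ z))) ⟩
        sum (λ z → sum (λ y → Col y z))
          ≡⟨ ∑-comm (λ z y → Col y z) ⟩
        sum (λ y → sum (Col y)) ∎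
        where open ≡-Reasoning
      vanish : ∀ y → (∀ {w} → w ∈ L → ¬ (0 < W y (σ ⟨$⟩ʳ w))) → sum (Col y) ≡ 0
      vanish y h = sum-zero λ z → lemma z
        where
        lemma : ∀ z → Col y z ≡ 0
        lemma z with z ∈? L
        ... | yes z∈ = ℕ.n≤0⇒n≡0 (ℕ.≮⇒≥ (h z∈))
        ... | no _   = refl
      bound : ∀ y → sum (Col y) ≤ capacity y
      bound y with y ∈? L
      ... | no y∉ = ℕ.≤-reflexive (vanish y (noArc y∉))
      ... | yes _ = ℕ.≤-trans (sum-mono-≤ drop)
                      (ℕ.≤-reflexive (trans (sym (sum-permute (W y) σ)) (rows y)))
        where
        drop : ∀ z → Col y z ≤ W y (σ ⟨$⟩ʳ z)
        drop z with z ∈? L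
        ... | yes _ = ℕ.≤-refl
        ... | no _  = z≤n
      strict : sum (Col x₀) < capacity x₀
      strict rewrite vanish x₀ noLoop with x₀ ∈? L
      ... | yes _ = s≤s z≤n
      ... | no x∉ = contradiction (x₀∈ c) x∉

    repair : ∃ λ τ → 0 < W x₀ (τ ⟨$⟩ʳ x₀) × Preserves τ
    -- The invariant `n < length L + fuel` lets the fuel run out only at a chain longer than `n`,
    -- which `chain-unique` rules out.
    repair = search n base (ℕ.n<1+n n)
      where
      search : ∀ fuel {L} → Chain L → n < length L + fuel → ∃ λ τ → 0 < W x₀ (τ ⟨$⟩ʳ x₀) × Preserves τ
      search fuel {L} c lt with Fin.any? (λ w → (w ∈? L) ×-dec (0 <? W x₀ (σ ⟨$⟩ʳ w)))
      ... | yes (w , w∈ , p) with τ , e , pres , _ ← rotate c w∈ =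
        τ , subst (λ y → 0 < W x₀ y) (sym e) p , pres
      ... | no noLoop
        with Fin.any? (λ z → Fin.any? λ w → ¬? (z ∈? L) ×-dec (w ∈? L) ×-dec (0 <? W z (σ ⟨$⟩ʳ w)))
      ...   | no noArc = ⊥-elim (closed-absurd c (λ w∈ p → noLoop (_ , w∈ , p))
                                    (λ z∉ w∈ p → noArc (_ , _ , z∉ , w∈ , p)))
      search zero {L} c lt | no _ | yes (z , w , z∉ , w∈ , p) =
        contradiction (unique-length≤ (chain-unique c)) (ℕ.<⇒≱ (subst (n <_) (ℕ.+-identityʳ _) lt))
      search (suc fuel) {L} c lt | no _ | yes (z , w , z∉ , w∈ , p) =
        search fuel (grow c w∈ z∉ p) (subst (n <_) (ℕ.+-suc (length L) fuel) lt)

  repairs : ∀ xs → ∃ λ (σ : Permutation′ n) → ∀ {x} → x ∈ xs → 0 < W x (σ ⟨$⟩ʳ x)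
  repairs [] = Perm.id , λ ()
  repairs (x₀ ∷ xs) with σ , good ← repairs xs with τ , p , pres ← repair σ x₀ = τ , good′
    where
    good′ : ∀ {x} → x ∈ x₀ ∷ xs → 0 < W x (τ ⟨$⟩ʳ x)
    good′ (here refl) = p
    good′ {x} (there x∈) with x Fin.≟ x₀
    ... | yes refl = p
    ... | no x≢ with pres x x≢
    ...   | inj₁ q = q
    ...   | inj₂ e = subst (λ y → 0 < W x y) (sym e) (good x∈)

  positive-diagonal : ∃ λ (σ : Permutation′ n) → ∀ x → 0 < W x (σ ⟨$⟩ʳ x)
  positive-diagonal with σ , good ← repairs (allFin n) = σ , λ x → good (∈-allFin x)

module _ {n : ℕ} (W : Fin n → Fin n → ℕ) (k : ℕ)
  (W-sym : ∀ x y → W x y ≡ W y x) (rows : ∀ x → sum (W x) ≡ suc k)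
  (c : Fin n → Bool) (bip : ∀ x y → 0 < W x y → c x ≢ c y) where

  abstract
    -- A positive diagonal need not be an involution. Taking `σ` on one colour class and its inverse
    -- on the other makes it one, since positive entries join different colours.
    perfect-matching : ∃ λ (m : Fin n → Fin n) → (∀ x → 0 < W x (m x)) × (∀ x → m (m x) ≡ x)
    perfect-matching
      with σ , pos ← PositiveDiagonal.positive-diagonal W k rows
                       (λ y → trans (sum-cong-≗ λ x → W-sym x y) (rows y)) = m , m-pos , m-inv
      where
      m : Fin n → Fin n
      m x = if c x then σ ⟨$⟩ʳ x else σ ⟨$⟩ˡ x
      posˡ : ∀ x → 0 < W x (σ ⟨$⟩ˡ x)
      posˡ x = subst (0 <_) (trans (cong (W (σ ⟨$⟩ˡ x)) (Perm.inverseʳ σ)) (W-sym _ _)) (pos (σ ⟨$⟩ˡ x))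
      m-pos : ∀ x → 0 < W x (m x)
      m-pos x with c x
      ... | true  = pos x
      ... | false = posˡ x
      m-inv : ∀ x → m (m x) ≡ x
      m-inv x with c x in eq
      ... | true with c (σ ⟨$⟩ʳ x) in eq′
      ...   | true  = contradiction (trans eq (sym eq′)) (bip _ _ (pos x))
      ...   | false = Perm.inverseˡ σ
      m-inv x | false with c (σ ⟨$⟩ˡ x) in eq′
      ...   | true  = Perm.inverseʳ σ
      ...   | false = contradiction (trans eq (sym eq′)) (bip _ _ (posˡ x))

-- Indicators and Boolean equality

𝟙 : Bool → ℕ
𝟙 b = if b then 1 else 0

𝟙-positive : ∀ {b} → 0 < 𝟙 b → b ≡ true
𝟙-positive {true} _ = refl

_==_ : ∀ {n} → Fin n → Fin n → Bool
x == y = does (x Fin.≟ y)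

==-yes : ∀ {n} {x y : Fin n} → x ≡ y → (x == y) ≡ true
==-yes {x = x} {y} e with x Fin.≟ y
... | yes _ = refl
... | no ne = contradiction e ne

==-no : ∀ {n} {x y : Fin n} → x ≢ y → (x == y) ≡ false
==-no {x = x} {y} ne with x Fin.≟ y
... | yes e = contradiction e ne
... | no _  = refl

==-sound : ∀ {n} {x y : Fin n} → (x == y) ≡ true → x ≡ y
==-sound {x = x} {y} h with x Fin.≟ y
... | yes e = e

∧-true : ∀ {a b} → a ∧ b ≡ true → a ≡ true × b ≡ true
∧-true {true} e = refl , e

sum-𝟙-== : ∀ {n} b (z : Fin n) → sum (λ y → 𝟙 (b ∧ (z == y))) ≡ 𝟙 b
sum-𝟙-== {n} false z = sum-zero {n} λ _ → refl
sum-𝟙-== true  z = trans (sum-single z λ j j≢z → cong 𝟙 (==-no (j≢z ∘ sym))) (cong 𝟙 (==-yes {x = z} refl))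

≢⇒≡ : ∀ {a b d : Bool} → a ≢ d → b ≢ d → a ≡ b
≢⇒≡ {false} {false} _ _ = refl
≢⇒≡ {true}  {true}  _ _ = refl
≢⇒≡ {true}  {false} {true}  a _ = contradiction refl a
≢⇒≡ {true}  {false} {false} _ b = contradiction refl b
≢⇒≡ {false} {true}  {true}  _ b = contradiction refl b
≢⇒≡ {false} {true}  {false} a _ = contradiction refl a

-- Neighbourhoods in a cubic graph

module CubicGraph {n : ℕ} (G : Graph n) (cubic : Cubic G) where

  V : Set
  V = Fin n

  infix 4 _~_
  _~_ : V → V → Set
  _~_ = Adj G

  ~-sym : ∀ {u v} → u ~ v → v ~ u
  ~-sym {u} {v} a = trans (symm G v u) a

  ~⇒≢ : ∀ {u v} → u ~ v → u ≢ v
  ~⇒≢ {u} a refl with () ← trans (sym a) (irrefl G u)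

  record Nbrs (u a b d : V) : Set where
    constructor mkNbrs
    field
      a≢b : a ≢ b
      a≢d : a ≢ d
      b≢d : b ≢ d
      ~a  : u ~ a
      ~b  : u ~ b
      ~d  : u ~ d
      exhaust : ∀ {v} → u ~ v → v ≡ a ⊎ v ≡ b ⊎ v ≡ d

  swap₁₂ : ∀ {u a b d} → Nbrs u a b d → Nbrs u b a d
  swap₁₂ (mkNbrs ab ad bd a b d ex) = mkNbrs (ab ∘ sym) bd ad b a d (swap ∘ ex)
    where
    swap : ∀ {A B C : Set} → A ⊎ B ⊎ C → B ⊎ A ⊎ C
    swap (inj₁ x)        = inj₂ (inj₁ x)
    swap (inj₂ (inj₁ x)) = inj₁ x
    swap (inj₂ (inj₂ x)) = inj₂ (inj₂ x)

  swap₂₃ : ∀ {u a b d} → Nbrs u a b d → Nbrs u a d b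
  swap₂₃ (mkNbrs ab ad bd a b d ex) = mkNbrs ad ab (bd ∘ sym) a d b (swap ∘ ex)
    where
    swap : ∀ {A B C : Set} → A ⊎ B ⊎ C → A ⊎ C ⊎ B
    swap (inj₁ x)        = inj₁ x
    swap (inj₂ (inj₁ x)) = inj₂ (inj₂ x)
    swap (inj₂ (inj₂ x)) = inj₂ (inj₁ x)

  abstract
    neighbours : ∀ u → ∃ λ a → ∃ λ b → ∃ λ d → Nbrs u a b d
    neighbours u = extract (filter P? (allFin n)) (cubic u) (Unique.filter⁺ P? (Unique.allFin⁺ n))
      (λ a → ∈-filter⁺ P? (∈-allFin _) a) (λ m → proj₂ (∈-filter⁻ P? {xs = allFin n} m))
      where
      P? : ∀ v → Dec (u ~ v)
      P? v = adj G u v Bool.≟ true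
      extract : ∀ xs → length xs ≡ 3 → Unique xs → (∀ {v} → u ~ v → v ∈ xs) → (∀ {v} → v ∈ xs → u ~ v) →
        ∃ λ a → ∃ λ b → ∃ λ d → Nbrs u a b d
      extract (a ∷ b ∷ d ∷ []) refl ((ab ∷ ad ∷ []) ∷ (bd ∷ []) ∷ _) to from =
        a , b , d , mkNbrs ab ad bd (from (here refl)) (from (there (here refl)))
          (from (there (there (here refl)))) (pick ∘ to)
        where
        pick : ∀ {v} → v ∈ a ∷ b ∷ d ∷ [] → v ≡ a ⊎ v ≡ b ⊎ v ≡ d
        pick (here e)                 = inj₁ e
        pick (there (here e))         = inj₂ (inj₁ e)
        pick (there (there (here e))) = inj₂ (inj₂ e)

    with-first : ∀ {u a} → u ~ a → ∃ λ b → ∃ λ d → Nbrs u a b d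
    with-first {u} ua with x , y , z , N ← neighbours u with Nbrs.exhaust N ua
    ... | inj₁ refl        = _ , _ , N
    ... | inj₂ (inj₁ refl) = _ , _ , swap₁₂ N
    ... | inj₂ (inj₂ refl) = _ , _ , swap₁₂ (swap₂₃ N)

    third : ∀ {u a b} → u ~ a → u ~ b → a ≢ b → ∃ λ d → Nbrs u a b d
    third ua ub a≢b with x , y , N ← with-first ua with Nbrs.exhaust N ub
    ... | inj₁ refl        = contradiction refl a≢b
    ... | inj₂ (inj₁ refl) = _ , N
    ... | inj₂ (inj₂ refl) = _ , swap₂₃ N

  sum-neighbours : ∀ {u a b d} → Nbrs u a b d → (f : V → Bool) →
    sum (λ v → 𝟙 (adj G u v ∧ f v)) ≡ 𝟙 (f a) + (𝟙 (f b) + 𝟙 (f d))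
  sum-neighbours {u} N f = trans (sum-triple a≢b a≢d b≢d zeros)
      (cong₂ _+_ (at ~a) (cong₂ _+_ (at ~b) (at ~d)))
    where
    open Nbrs N
    at : ∀ {v} → u ~ v → 𝟙 (adj G u v ∧ f v) ≡ 𝟙 (f v)
    at {v} a = cong (λ z → 𝟙 (z ∧ f v)) a
    zeros : ∀ v → v ≢ _ → v ≢ _ → v ≢ _ → 𝟙 (adj G u v ∧ f v) ≡ 0
    zeros v p q r with adj G u v in e
    ... | false = refl
    ... | true with exhaust e
    ...   | inj₁ x        = contradiction x p
    ...   | inj₂ (inj₁ x) = contradiction x q
    ...   | inj₂ (inj₂ x) = contradiction x r

  -- A family of vertex-disjoint squares: o u is the vertex opposite to u in its square and p u is a
  -- distinguished neighbour of u there, shared by u and o u. Vertices off the family are fixed by o and p.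
  record Family : Set where
    field
      o p     : V → V
      o-invol : ∀ u → o (o u) ≡ u
      p-o     : ∀ u → p (o u) ≡ p u
      p-ppp   : ∀ u → p (p (p u)) ≡ p u
      pp∈     : ∀ u → p (p u) ≡ u ⊎ p (p u) ≡ o u
      p-out   : ∀ {u} → o u ≡ u → p u ≡ u
      p-in    : ∀ {u} → o u ≢ u → o (p u) ≢ p u
      adj-p   : ∀ {u} → o u ≢ u → u ~ p u
      adj-op  : ∀ {u} → o u ≢ u → u ~ o (p u)

  record Matching : Set where
    field
      M       : V → V
      M-adj   : ∀ u → u ~ M u
      M-invol : ∀ u → M (M u) ≡ u

    M-sym : ∀ {u v} → M u ≡ v → M v ≡ u
    M-sym {u} e = trans (cong M (sym e)) (M-invol u)

  -- The contracted multigraph and the lifting of its matchings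

  -- Contracting every square of the family to an edge {rep u , p u} gives a cubic bipartite multigraph;
  -- a perfect matching of it lifts to one of G meeting every square of the family. To keep the vertex
  -- set, the non-representatives of a square are joined to each other by three parallel edges, and the
  -- edge uv of G is moved to the edge {L u v , L v u}.
  module Contraction (c : V → Bool) (bip : ∀ u v → u ~ v → c u ≢ c v) (F : Family) where
    open Family F

    -- In a square `p` sends both vertices of an opposite pair to the chosen vertex of the other
    -- pair; applied twice it yields the chosen vertex of the pair itself. Off the family `rep u` is
    -- `u`.
    rep : V → V
    rep u = p (p u)

    rep-o : ∀ u → rep (o u) ≡ rep u
    rep-o u = cong p (p-o u)

    rep-p : ∀ u → rep (p u) ≡ p u
    rep-p = p-ppp

    rep-rep : ∀ u → rep (rep u) ≡ rep u
    rep-rep u = rep-p (p u)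

    rep-≡ : ∀ {w u} → rep w ≡ rep u → w ≡ u ⊎ w ≡ o u
    rep-≡ {w} {u} e with pp∈ w | pp∈ u
    ... | inj₁ a | inj₁ b = inj₁ (trans (sym a) (trans e b))
    ... | inj₁ a | inj₂ b = inj₂ (trans (sym a) (trans e b))
    ... | inj₂ a | inj₁ b = inj₂ (trans (sym (o-invol w)) (cong o (trans (sym a) (trans e b))))
    ... | inj₂ a | inj₂ b = inj₁ (trans (sym (o-invol w)) (trans (cong o (trans (sym a) (trans e b))) (o-invol u)))

    o-in : ∀ {u} → o u ≢ u → o (o u) ≢ o u
    o-in {u} h e = h (trans (sym e) (o-invol u))

    c-o : ∀ u → c (o u) ≡ c u
    c-o u with o u Fin.≟ u
    ... | yes e = cong c e
    ... | no h  = ≢⇒≡ (bip _ _ (adj-p (o-in h))) (bip _ _ (subst (u ~_) (sym (p-o u)) (adj-p h)))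

    -- In a square with representatives `r` and `s`, the edge from `r` to `s` stays where it is, and
    -- the other three edges all become edges from `o r` to `o s`. An edge leaving the square is
    -- attached to the representative.
    L : V → V → V
    L u v = if rep v == p u then (if v == p u then u else o (rep u)) else rep u

    L-p : ∀ u → L u (p u) ≡ u
    L-p u rewrite ==-yes (rep-p u) | ==-yes {x = p u} refl = refl

    L-op : ∀ {u} → o u ≢ u → L u (o (p u)) ≡ o (rep u)
    L-op {u} h rewrite ==-yes (trans (rep-o (p u)) (rep-p u)) | ==-no (p-in h) = refl

    L-ext : ∀ {u v} → rep v ≢ p u → L u v ≡ rep u
    L-ext h rewrite ==-no h = refl

    L-rep : ∀ u v → rep (L u v) ≡ rep u
    L-rep u v with rep v == p u
    ... | false = rep-rep u
    ... | true with v == p u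
    ...   | true  = refl
    ...   | false = trans (rep-o (rep u)) (rep-rep u)

    L-c : ∀ u v → c (L u v) ≡ c u
    L-c u v with rep-≡ (L-rep u v)
    ... | inj₁ e = cong c e
    ... | inj₂ e = trans (cong c e) (c-o u)

    -- The only edges moved to a non-representative are three edges of a square, and these are so
    -- moved at both ends. Hence a matching of the multigraph pairs representatives with
    -- representatives, which is `m-low`.
    L-low : ∀ {u v} → u ~ v → L u v ≡ rep u → L v u ≡ rep v
    L-low {u} {v} uv h = by-cases (rep v Fin.≟ p u)
      where
      by-cases : _ → L v u ≡ rep v
      by-cases (no ne) = L-ext λ e → ne (trans (cong p (sym e)) (p-ppp u))
      by-cases (yes e) = inside (v Fin.≟ p u)
       where
       inside : _ → L v u ≡ rep v
       inside (yes f) = trans (cong (L v) u≡pv) (trans (L-p v) (trans f (sym e)))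
        where
        u≡pv : u ≡ p v
        u≡pv = trans (sym (L-p u)) (trans (cong (L u) (sym f)) (trans h (cong p (sym f))))
       inside (no ne) = contradiction (trans (sym Luv) h) (p-in (p-in u-in))
        where
        u-in : o u ≢ u
        u-in q with rep-≡ (trans e (trans (p-out q) (sym (trans (cong p (p-out q)) (p-out q)))))
        ... | inj₁ v≡u  = ~⇒≢ uv (sym v≡u)
        ... | inj₂ v≡ou = ~⇒≢ uv (sym (trans v≡ou q))
        Luv : L u v ≡ o (rep u)
        Luv rewrite ==-yes e | ==-no ne = refl

    W : V → V → ℕ
    W x y = sum λ u → sum λ v → 𝟙 (adj G u v ∧ ((L u v == x) ∧ (L v u == y)))

    W-sym : ∀ x y → W x y ≡ W y x
    W-sym x y = trans (∑-comm (λ u v → 𝟙 (adj G u v ∧ ((L u v == x) ∧ (L v u == y))))) (sum-cong-≗ λ v → sum-cong-≗ λ u →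
      cong 𝟙 (cong₂ _∧_ (symm G u v) (Bool.∧-comm (L u v == x) (L v u == y))))

    abstract
      dart : ∀ x y → 0 < W x y → ∃ λ u → ∃ λ v → u ~ v × L u v ≡ x × L v u ≡ y
      dart x y h =
        let u , hu  = sum-positive⁻ {f = λ u → sum λ v → 𝟙 (adj G u v ∧ ((L u v == x) ∧ (L v u == y)))} h
            v , hv  = sum-positive⁻ {f = λ v → 𝟙 (adj G u v ∧ ((L u v == x) ∧ (L v u == y)))} hu
            a , b   = ∧-true (𝟙-positive hv)
            b₁ , b₂ = ∧-true {L u v == x} b
        in u , v , a , ==-sound b₁ , ==-sound b₂

    W-bip : ∀ x y → 0 < W x y → c x ≢ c y
    W-bip x y h with u , v , a , refl , refl ← dart x y h =
      λ e → bip u v a (trans (sym (L-c u v)) (trans e (L-c v u)))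

    star : V → V → ℕ
    star x u = sum λ v → 𝟙 (adj G u v ∧ (L u v == x))

    star-zero : ∀ {x u} → u ≢ x → u ≢ o x → star x u ≡ 0
    star-zero {x} {u} h h′ = sum-zero λ v → trans (cong (λ b → 𝟙 (adj G u v ∧ b)) (==-no λ e → miss v e))
        (cong 𝟙 (Bool.∧-zeroʳ (adj G u v)))
      where
      miss : ∀ v → L u v ≢ x
      miss v e with rep-≡ (trans (sym (L-rep u v)) (cong rep e))
      ... | inj₁ q = h q
      ... | inj₂ q = h′ q

    -- Only edges at `x` or `o x` can be moved to `x`. In a square these two vertices carry six edge
    -- ends: the representative receives those of the two edges leaving the square and of the edge
    -- to the other representative; its opposite receives the remaining three.
    stars : ∀ x → sum (star x) ≡ 3
    stars x with o x Fin.≟ x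
    ... | yes q with a , b , d , N ← neighbours x = trans (sum-single x λ u h → star-zero h (λ e → h (trans e q)))
            (trans (sum-neighbours N _) (cong₂ _+_ (one a) (cong₂ _+_ (one b) (one d))))
      where
      one : ∀ v → 𝟙 (L x v == x) ≡ 1
      one v with rep-≡ (L-rep x v)
      ... | inj₁ e = cong 𝟙 (==-yes e)
      ... | inj₂ e = cong 𝟙 (==-yes (trans e q))
    ... | no h with d , N ← third (adj-p h) (adj-op h) (p-in h ∘ sym)
      with d′ , N′ ← third (subst (o x ~_) (p-o x) (adj-p (o-in h)))
                           (subst (λ z → o x ~ o z) (p-o x) (adj-op (o-in h))) (p-in h ∘ sym) =
        trans (sum-pair (h ∘ sym) (λ l → star-zero)) (trans (cong₂ _+_ (sum-neighbours N _) (sum-neighbours N′ _)) count)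
      where
      ext : ∀ {v} → p x ≢ v → o (p x) ≢ v → rep v ≢ p x
      ext a b e with rep-≡ (trans e (sym (rep-p x)))
      ... | inj₁ q = a (sym q)
      ... | inj₂ q = b (sym q)
      e₃ : L x d ≡ rep x
      e₃ = L-ext (ext (Nbrs.a≢d N) (Nbrs.b≢d N))
      e₄ : L (o x) (p x) ≡ o x
      e₄ = trans (cong (L (o x)) (sym (p-o x))) (L-p (o x))
      e₅ : L (o x) (o (p x)) ≡ o (rep x)
      e₅ = trans (cong (λ z → L (o x) (o z)) (sym (p-o x))) (trans (L-op (o-in h)) (cong o (rep-o x)))
      e₆ : L (o x) d′ ≡ rep x
      e₆ = trans (L-ext (λ e → ext (Nbrs.a≢d N′) (Nbrs.b≢d N′) (trans e (p-o x)))) (rep-o x)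
      count : 𝟙 (L x (p x) == x) + (𝟙 (L x (o (p x)) == x) + 𝟙 (L x d == x))
            + (𝟙 (L (o x) (p x) == x) + (𝟙 (L (o x) (o (p x)) == x) + 𝟙 (L (o x) d′ == x))) ≡ 3
      count rewrite L-p x | L-op h | e₃ | e₄ | e₅ | e₆ | ==-yes {x = x} refl | ==-no h with pp∈ x
      ... | inj₁ e rewrite e | ==-no h | ==-yes {x = x} refl = refl
      ... | inj₂ e rewrite e | o-invol x | ==-no h | ==-yes {x = x} refl = refl

    W-rows : ∀ x → sum (W x) ≡ 3
    W-rows x = begin
      sum (λ y → sum λ u → sum λ v → E u v y)   ≡⟨ ∑-comm (λ y u → sum λ v → E u v y) ⟩
      sum (λ u → sum λ y → sum λ v → E u v y)   ≡⟨ sum-cong-≗ (λ u → ∑-comm (λ y v → E u v y)) ⟩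
      sum (λ u → sum λ v → sum λ y → E u v y)   ≡⟨ sum-cong-≗ (λ u → sum-cong-≗ λ v → collapse u v) ⟩
      sum (star x)                                ≡⟨ stars x ⟩
      3 ∎
      where
      open ≡-Reasoning
      E : V → V → V → ℕ
      E u v y = 𝟙 (adj G u v ∧ ((L u v == x) ∧ (L v u == y)))
      collapse : ∀ u v → sum (E u v) ≡ 𝟙 (adj G u v ∧ (L u v == x))
      collapse u v = trans (sum-cong-≗ λ y → cong 𝟙 (sym (Bool.∧-assoc (adj G u v) (L u v == x) (L v u == y))))
        (sum-𝟙-== (adj G u v ∧ (L u v == x)) (L v u))

    module Ends (m : V → V) (m-pos : ∀ x → 0 < W x (m x)) (m-invol : ∀ x → m (m x) ≡ x) where

      chosen : ∀ x → ∃ λ u → ∃ λ v → u ~ v × L u v ≡ x × L v u ≡ m x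
      chosen x = dart x (m x) (m-pos x)

      -- With parallel edges, the edges of `G` chosen for `x` and for `m x` may differ. The choice
      -- made at the vertex coloured `true` is used for both.
      end : V → V
      end x = if c x then proj₁ (chosen x) else proj₁ (proj₂ (chosen (m x)))

      end-props : ∀ x → end x ~ end (m x) × L (end x) (end (m x)) ≡ x
      end-props x with c x in e | c (m x) in e′
      ... | true  | true  = contradiction (trans e (sym e′)) (W-bip _ _ (m-pos x))
      ... | false | false = contradiction (trans e (sym e′)) (W-bip _ _ (m-pos x))
      ... | true  | false rewrite m-invol x = proj₁ d , proj₁ (proj₂ d)
        where d = proj₂ (proj₂ (chosen x))
      ... | false | true = ~-sym (proj₁ d) , trans (proj₂ (proj₂ d)) (m-invol x)
        where d = proj₂ (proj₂ (chosen (m x)))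

    module Lift (m : V → V) (m-invol : ∀ x → m (m x) ≡ x) (end : V → V)
      (end-props : ∀ x → end x ~ end (m x) × L (end x) (end (m x)) ≡ x) where

      end-rep : ∀ x → rep (end x) ≡ rep x
      end-rep x = trans (sym (L-rep _ _)) (cong rep (proj₂ (end-props x)))

      m-low : ∀ {x} → rep x ≡ x → rep (m x) ≡ m x
      m-low {x} low = trans (sym (end-rep (m x))) (trans (sym flipped) back)
        where
        flipped : L (end (m x)) (end x) ≡ rep (end (m x))
        flipped = L-low (proj₁ (end-props x)) (trans (proj₂ (end-props x)) (sym (trans (end-rep x) low)))
        back : L (end (m x)) (end x) ≡ m x
        back = trans (cong (λ z → L (end (m x)) (end z)) (sym (m-invol x))) (proj₂ (end-props (m x)))

      abstract
        -- Of the pair `u`, `o u`, exactly one is the end of the edge chosen at `rep u`, and it is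
        -- matched along that edge. The other is matched to the vertex left over in the opposite
        -- pair of the square. Vertices off the family are always ends.
        N : V → V
        N u = if end (rep u) == u then end (m (rep u)) else o (end (p u))

        N-yes : ∀ {u} → end (rep u) ≡ u → N u ≡ end (m (rep u))
        N-yes e rewrite ==-yes e = refl

        N-no : ∀ {u} → end (rep u) ≢ u → N u ≡ o (end (p u))
        N-no e rewrite ==-no e = refl

      end-o : ∀ {u} → end (rep u) ≢ u → end (rep u) ≡ o u
      end-o {u} h with rep-≡ (trans (end-rep (rep u)) (rep-rep u))
      ... | inj₁ e = contradiction e h
      ... | inj₂ e = e

      in-square : ∀ {u} → end (rep u) ≢ u → o u ≢ u
      in-square h e = h (trans (end-o h) e)

      end-p : ∀ u → end (p u) ≡ p u ⊎ end (p u) ≡ o (p u)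
      end-p u = rep-≡ (end-rep (p u))

      N-square : ∀ {u} → end (rep u) ≢ u → N u ≡ p u ⊎ N u ≡ o (p u)
      N-square {u} h with end-p u
      ... | inj₁ e = inj₂ (trans (N-no h) (cong o e))
      ... | inj₂ e = inj₁ (trans (N-no h) (trans (cong o e) (o-invol (p u))))

      N-adj : ∀ u → u ~ N u
      N-adj u with end (rep u) Fin.≟ u
      ... | yes e = subst₂ _~_ e (sym (N-yes e)) (proj₁ (end-props (rep u)))
      ... | no h with N-square h
      ...   | inj₁ e = subst (u ~_) (sym e) (adj-p (in-square h))
      ...   | inj₂ e = subst (u ~_) (sym e) (adj-op (in-square h))

      N-invol : ∀ u → N (N u) ≡ u
      N-invol u with end (rep u) Fin.≟ u
      ... | yes e = trans (cong N (N-yes e)) (trans (N-yes at-v) (trans (cong (end ∘ m) rep-v)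
                      (trans (cong end (m-invol (rep u))) e)))
        where
        v = end (m (rep u))
        rep-v : rep v ≡ m (rep u)
        rep-v = trans (end-rep (m (rep u))) (m-low (rep-rep u))
        at-v : end (rep v) ≡ v
        at-v = cong end rep-v
      ... | no h = trans (cong N (N-no h)) (trans (N-no at-v) (trans (cong o end-pv) (o-invol u)))
        where
        w = end (p u)
        rep-w : rep w ≡ p u
        rep-w = trans (end-rep (p u)) (rep-p u)
        w-in : o w ≢ w
        w-in q with end-p u
        ... | inj₁ e = p-in (in-square h) (subst (λ z → o z ≡ z) e q)
        ... | inj₂ e = o-in (p-in (in-square h)) (subst (λ z → o z ≡ z) e q)
        at-v : end (rep (o w)) ≢ o w
        at-v q = w-in (trans (sym q) (cong end (trans (rep-o w) rep-w)))
        end-pv : end (p (o w)) ≡ o u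
        end-pv = trans (cong end (trans (p-o w) (trans (sym (p-ppp w)) (cong p rep-w)))) (end-o h)

      -- Only one vertex of the pair is an end, so in a square the other is matched inside it.
      N-hits : ∀ u → (N u ≡ p u ⊎ N u ≡ o (p u)) ⊎ (N (o u) ≡ p u ⊎ N (o u) ≡ o (p u)) ⊎ o u ≡ u
      N-hits u with o u Fin.≟ u
      ... | yes e = inj₂ (inj₂ e)
      ... | no ne with end (rep u) Fin.≟ u
      ...   | no h = inj₁ (N-square h)
      ...   | yes e = inj₂ (inj₁ (subst (λ z → N (o u) ≡ z ⊎ N (o u) ≡ o z) (p-o u)
                        (N-square {o u} λ q → ne (trans (sym q) (trans (cong end (rep-o u)) e)))))


    abstract
      matching : ∃ λ (𝑴 : Matching) → let open Matching 𝑴 in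
        ∀ u → (M u ≡ p u ⊎ M u ≡ o (p u)) ⊎ (M (o u) ≡ p u ⊎ M (o u) ≡ o (p u)) ⊎ o u ≡ u
      matching with m , m-pos , m-invol ← perfect-matching W 2 W-sym W-rows c W-bip =
        record { M = N ; M-adj = N-adj ; M-invol = N-invol } , N-hits
        where
        open Ends m m-pos m-invol
        open Lift m m-invol end end-props

-- 4-cycles and a maximal disjoint family of them

module Squares {n : ℕ} (G : Graph n) (cubic : Cubic G)
  (c : Fin n → Bool) (bip : ∀ u v → Adj G u v → c u ≢ c v) where
  open CubicGraph G cubic

  record Square (w x y z : V) : Set where
    constructor mkSquare
    field
      wx  : w ~ x
      xy  : x ~ y
      yz  : y ~ z
      zw  : z ~ w
      w≢y : w ≢ y
      x≢z : x ≢ z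

  square? : ∀ w x y z → Dec (Square w x y z)
  square? w x y z with adj G w x Bool.≟ true | adj G x y Bool.≟ true | adj G y z Bool.≟ true
    | adj G z w Bool.≟ true | w Fin.≟ y | x Fin.≟ z
  ... | yes a | yes b | yes d | yes e | no f | no g = yes (mkSquare a b d e f g)
  ... | no h | _ | _ | _ | _ | _ = no (h ∘ Square.wx)
  ... | _ | no h | _ | _ | _ | _ = no (h ∘ Square.xy)
  ... | _ | _ | no h | _ | _ | _ = no (h ∘ Square.yz)
  ... | _ | _ | _ | no h | _ | _ = no (h ∘ Square.zw)
  ... | _ | _ | _ | _ | yes h | _ = no λ s → Square.w≢y s h
  ... | _ | _ | _ | _ | _ | yes h = no λ s → Square.x≢z s h

  turn : ∀ {w x y z} → Square w x y z → Square x y z w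
  turn (mkSquare a b d e f g) = mkSquare b d e a g (f ∘ sym)

  mirror : ∀ {w x y z} → Square w x y z → Square x w z y
  mirror (mkSquare a b d e f g) = mkSquare (~-sym a) (~-sym e) (~-sym d) (~-sym b) g f

  flip-square : ∀ {w x y z} → Square w x y z → Square w z y x
  flip-square = turn ∘ mirror

  quads : List (V × V × V × V)
  quads = cartesianProduct (allFin n) (cartesianProduct (allFin n) (cartesianProduct (allFin n) (allFin n)))

  ∈-quads : ∀ q → q ∈ quads
  ∈-quads (w , x , y , z) = ∈-cartesianProduct⁺ (∈-allFin w)
    (∈-cartesianProduct⁺ (∈-allFin x) (∈-cartesianProduct⁺ (∈-allFin y) (∈-allFin z)))

  Meets : Family → V → V → V → V → Set
  Meets F w x y z = let open Family F in o w ≢ w ⊎ o x ≢ x ⊎ o y ≢ y ⊎ o z ≢ z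

  meets? : ∀ F w x y z → Dec (Meets F w x y z)
  meets? F w x y z = let open Family F in
    ¬? (o w Fin.≟ w) ⊎-dec ¬? (o x Fin.≟ x) ⊎-dec ¬? (o y Fin.≟ y) ⊎-dec ¬? (o z Fin.≟ z)

  empty : Family
  empty = record
    { o = id ; p = id ; o-invol = λ _ → refl ; p-o = λ _ → refl ; p-ppp = λ _ → refl
    ; pp∈ = λ _ → inj₁ refl ; p-out = λ _ → refl ; p-in = id
    ; adj-p = contradiction refl ; adj-op = contradiction refl }

  module Add (F : Family) {w x y z : V} (S : Square w x y z) (off : ¬ Meets F w x y z) where
    open Family F
    open Square S

    fixed : ∀ {v} → ¬ (o v ≢ v) → o v ≡ v
    fixed {v} = decidable-stable (o v Fin.≟ v)
    ow : o w ≡ w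
    ow = fixed (off ∘ inj₁)
    ox : o x ≡ x
    ox = fixed (off ∘ inj₂ ∘ inj₁)
    oy : o y ≡ y
    oy = fixed (off ∘ inj₂ ∘ inj₂ ∘ inj₁)
    oz : o z ≡ z
    oz = fixed (off ∘ inj₂ ∘ inj₂ ∘ inj₂)

    data View : V → Set where
      at-w : View w
      at-x : View x
      at-y : View y
      at-z : View z
      away : ∀ {v} → v ≢ w → v ≢ x → v ≢ y → v ≢ z → View v

    view : ∀ v → View v
    view v with v Fin.≟ w | v Fin.≟ x | v Fin.≟ y | v Fin.≟ z
    ... | yes refl | _ | _ | _ = at-w
    ... | no _ | yes refl | _ | _ = at-x
    ... | no _ | no _ | yes refl | _ = at-y
    ... | no _ | no _ | no _ | yes refl = at-z
    ... | no a | no b | no d | no e = away a b d e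

    o′ : V → V
    o′ v = if v == w then y else if v == x then z else if v == y then w else if v == z then x else o v

    p′ : V → V
    p′ v = if v == w then x else if v == x then w else if v == y then x else if v == z then w else p v

    x≢w : x ≢ w
    x≢w = ~⇒≢ wx ∘ sym
    y≢x : y ≢ x
    y≢x = ~⇒≢ xy ∘ sym
    z≢y : z ≢ y
    z≢y = ~⇒≢ yz ∘ sym
    z≢w : z ≢ w
    z≢w = ~⇒≢ zw

    o′w : o′ w ≡ y
    o′w rewrite ==-yes {x = w} refl = refl
    o′x : o′ x ≡ z
    o′x rewrite ==-no x≢w | ==-yes {x = x} refl = refl
    o′y : o′ y ≡ w
    o′y rewrite ==-no (w≢y ∘ sym) | ==-no y≢x | ==-yes {x = y} refl = refl
    o′z : o′ z ≡ x
    o′z rewrite ==-no z≢w | ==-no (x≢z ∘ sym) | ==-no z≢y | ==-yes {x = z} refl = refl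
    o′-away : ∀ {v} → v ≢ w → v ≢ x → v ≢ y → v ≢ z → o′ v ≡ o v
    o′-away a b d e rewrite ==-no a | ==-no b | ==-no d | ==-no e = refl
    p′w : p′ w ≡ x
    p′w rewrite ==-yes {x = w} refl = refl
    p′x : p′ x ≡ w
    p′x rewrite ==-no x≢w | ==-yes {x = x} refl = refl
    p′y : p′ y ≡ x
    p′y rewrite ==-no (w≢y ∘ sym) | ==-no y≢x | ==-yes {x = y} refl = refl
    p′z : p′ z ≡ w
    p′z rewrite ==-no z≢w | ==-no (x≢z ∘ sym) | ==-no z≢y | ==-yes {x = z} refl = refl
    p′-away : ∀ {v} → v ≢ w → v ≢ x → v ≢ y → v ≢ z → p′ v ≡ p v
    p′-away a b d e rewrite ==-no a | ==-no b | ==-no d | ==-no e = refl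

    o-away : ∀ {v t} → o t ≡ t → v ≢ t → o v ≢ t
    o-away {v} ot h e = h (trans (sym (o-invol v)) (trans (cong o e) (trans ot refl)))

    p-away : ∀ {v t} → o t ≡ t → v ≢ t → p v ≢ t
    p-away {v} ot h e with o v Fin.≟ v
    ... | yes q = h (trans (sym (p-out q)) e)
    ... | no q  = p-in q (subst (λ s → o s ≡ s) (sym e) ot)

    p′o : ∀ {v} → v ≢ w → v ≢ x → v ≢ y → v ≢ z → p′ (o v) ≡ p (o v)
    p′o a b d e = p′-away (o-away ow a) (o-away ox b) (o-away oy d) (o-away oz e)
    o′o : ∀ {v} → v ≢ w → v ≢ x → v ≢ y → v ≢ z → o′ (o v) ≡ o (o v)
    o′o a b d e = o′-away (o-away ow a) (o-away ox b) (o-away oy d) (o-away oz e)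
    p′p : ∀ {v} → v ≢ w → v ≢ x → v ≢ y → v ≢ z → p′ (p v) ≡ p (p v)
    p′p a b d e = p′-away (p-away ow a) (p-away ox b) (p-away oy d) (p-away oz e)
    p′pp : ∀ {v} → v ≢ w → v ≢ x → v ≢ y → v ≢ z → p′ (p (p v)) ≡ p (p (p v))
    p′pp a b d e = p′p (p-away ow a) (p-away ox b) (p-away oy d) (p-away oz e)
    o′p : ∀ {v} → v ≢ w → v ≢ x → v ≢ y → v ≢ z → o′ (p v) ≡ o (p v)
    o′p a b d e = o′-away (p-away ow a) (p-away ox b) (p-away oy d) (p-away oz e)

    family : Family
    family = record
      { o = o′ ; p = p′ ; o-invol = inv ; p-o = po ; p-ppp = ppp ; pp∈ = pp ; p-out = out ; p-in = inn
      ; adj-p = ap ; adj-op = aop }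
      where
      inv : ∀ u → o′ (o′ u) ≡ u
      inv u with view u
      ... | at-w rewrite o′w = o′y
      ... | at-x rewrite o′x = o′z
      ... | at-y rewrite o′y = o′w
      ... | at-z rewrite o′z = o′x
      ... | away a b d e rewrite o′-away a b d e = trans (o′o a b d e) (o-invol u)
      po : ∀ u → p′ (o′ u) ≡ p′ u
      po u with view u
      ... | at-w rewrite o′w = trans p′y (sym p′w)
      ... | at-x rewrite o′x = trans p′z (sym p′x)
      ... | at-y rewrite o′y = trans p′w (sym p′y)
      ... | at-z rewrite o′z = trans p′x (sym p′z)
      ... | away a b d e rewrite o′-away a b d e | p′-away a b d e = trans (p′o a b d e) (p-o u)
      ppp : ∀ u → p′ (p′ (p′ u)) ≡ p′ u
      ppp u with view u
      ... | at-w rewrite p′w | p′x = p′w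
      ... | at-x rewrite p′x | p′w = p′x
      ... | at-y rewrite p′y | p′x = p′w
      ... | at-z rewrite p′z | p′w = p′x
      ... | away a b d e rewrite p′-away a b d e | p′p a b d e = trans (p′pp a b d e) (p-ppp u)
      pp : ∀ u → p′ (p′ u) ≡ u ⊎ p′ (p′ u) ≡ o′ u
      pp u with view u
      ... | at-w = inj₁ (trans (cong p′ p′w) p′x)
      ... | at-x = inj₁ (trans (cong p′ p′x) p′w)
      ... | at-y = inj₂ (trans (trans (cong p′ p′y) p′x) (sym o′y))
      ... | at-z = inj₂ (trans (trans (cong p′ p′z) p′w) (sym o′z))
      ... | away a b d e rewrite p′-away a b d e | o′-away a b d e | p′p a b d e = pp∈ u
      out : ∀ {u} → o′ u ≡ u → p′ u ≡ u
      out {u} h with view u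
      ... | at-w = contradiction (trans (sym h) o′w) w≢y
      ... | at-x = contradiction (trans (sym h) o′x) x≢z
      ... | at-y = contradiction (trans (sym o′y) h) w≢y
      ... | at-z = contradiction (trans (sym o′z) h) x≢z
      ... | away a b d e = trans (p′-away a b d e) (p-out (trans (sym (o′-away a b d e)) h))
      o′x≢ : o′ x ≢ x
      o′x≢ q = x≢z (trans (sym q) o′x)
      o′w≢ : o′ w ≢ w
      o′w≢ q = w≢y (trans (sym q) o′w)
      inn : ∀ {u} → o′ u ≢ u → o′ (p′ u) ≢ p′ u
      inn {u} h with view u
      ... | at-w = subst (λ v → o′ v ≢ v) (sym p′w) o′x≢
      ... | at-x = subst (λ v → o′ v ≢ v) (sym p′x) o′w≢
      ... | at-y = subst (λ v → o′ v ≢ v) (sym p′y) o′x≢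
      ... | at-z = subst (λ v → o′ v ≢ v) (sym p′z) o′w≢
      ... | away a b d e rewrite o′-away a b d e | p′-away a b d e | o′p a b d e = p-in h
      ap : ∀ {u} → o′ u ≢ u → u ~ p′ u
      ap {u} h with view u
      ... | at-w = subst (w ~_) (sym p′w) wx
      ... | at-x = subst (x ~_) (sym p′x) (~-sym wx)
      ... | at-y = subst (y ~_) (sym p′y) (~-sym xy)
      ... | at-z = subst (z ~_) (sym p′z) zw
      ... | away a b d e rewrite o′-away a b d e | p′-away a b d e = adj-p h
      aop : ∀ {u} → o′ u ≢ u → u ~ o′ (p′ u)
      aop {u} h with view u
      ... | at-w = subst (w ~_) (sym (trans (cong o′ p′w) o′x)) (~-sym zw)
      ... | at-x = subst (x ~_) (sym (trans (cong o′ p′x) o′w)) xy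
      ... | at-y = subst (y ~_) (sym (trans (cong o′ p′y) o′x)) yz
      ... | at-z = subst (z ~_) (sym (trans (cong o′ p′z) o′w)) (~-sym yz)
      ... | away a b d e rewrite o′-away a b d e | p′-away a b d e | o′p a b d e = adj-op h

    meets-new : Meets family w x y z
    meets-new = inj₁ λ q → w≢y (trans (sym q) o′w)

    keeps : ∀ {v} → o v ≢ v → o′ v ≢ v
    keeps {v} h with view v
    ... | at-w = contradiction ow h
    ... | at-x = contradiction ox h
    ... | at-y = contradiction oy h
    ... | at-z = contradiction oz h
    ... | away a b d e rewrite o′-away a b d e = h

  abstract
    -- A greedy pass over all quadruples: a square off the current family is added to it. By `keeps`
    -- the family never loses a vertex, so squares once met stay met.
    maximal-family : ∃ λ F → ∀ {w x y z} → Square w x y z → Meets F w x y z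
    maximal-family =
      let F , h = go quads in F , λ S → h (∈-quads _) S
      where
      Good : Family → List (V × V × V × V) → Set
      Good F qs = ∀ {w x y z} → (w , x , y , z) ∈ qs → Square w x y z → Meets F w x y z
      go : ∀ qs → ∃ λ F → Good F qs
      go [] = empty , λ ()
      go ((w , x , y , z) ∷ qs) with F , h ← go qs with square? w x y z | meets? F w x y z
      ... | no ¬S | _ = F , λ { (here refl) S → contradiction S ¬S ; (there m) S → h m S }
      ... | yes _ | yes q = F , λ { (here refl) S → q ; (there m) S → h m S }
      ... | yes S | no off = family , λ { (here refl) _ → meets-new ; (there m) S′ → up (h m S′) }
        where
        open Add F S off
        up : ∀ {a b d e} → Meets F a b d e → Meets family a b d e
        up (inj₁ h)               = inj₁ (keeps h)
        up (inj₂ (inj₁ h))        = inj₂ (inj₁ (keeps h))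
        up (inj₂ (inj₂ (inj₁ h))) = inj₂ (inj₂ (inj₁ (keeps h)))
        up (inj₂ (inj₂ (inj₂ h))) = inj₂ (inj₂ (inj₂ (keeps h)))

  -- Matchings that meet a 4-cycle, and switching

  Hit : Matching → V → V → V → V → Set
  Hit 𝑴 w x y z = let open Matching 𝑴 in M w ≡ x ⊎ M x ≡ y ⊎ M y ≡ z ⊎ M z ≡ w

  hit? : ∀ 𝑴 w x y z → Dec (Hit 𝑴 w x y z)
  hit? 𝑴 w x y z = let open Matching 𝑴 in
    (M w Fin.≟ x) ⊎-dec (M x Fin.≟ y) ⊎-dec (M y Fin.≟ z) ⊎-dec (M z Fin.≟ w)

  hit-turn : ∀ 𝑴 {w x y z} → Hit 𝑴 w x y z → Hit 𝑴 x y z w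
  hit-turn 𝑴 (inj₁ e)               = inj₂ (inj₂ (inj₂ e))
  hit-turn 𝑴 (inj₂ (inj₁ e))        = inj₁ e
  hit-turn 𝑴 (inj₂ (inj₂ (inj₁ e))) = inj₂ (inj₁ e)
  hit-turn 𝑴 (inj₂ (inj₂ (inj₂ e))) = inj₂ (inj₂ (inj₁ e))

  hit-mirror : ∀ 𝑴 {w x y z} → Hit 𝑴 w x y z → Hit 𝑴 x w z y
  hit-mirror 𝑴 = λ where
      (inj₁ e)               → inj₁ (M-sym e)
      (inj₂ (inj₁ e))        → inj₂ (inj₂ (inj₂ (M-sym e)))
      (inj₂ (inj₂ (inj₁ e))) → inj₂ (inj₂ (inj₁ (M-sym e)))
      (inj₂ (inj₂ (inj₂ e))) → inj₂ (inj₁ (M-sym e))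
    where open Matching 𝑴

  hit-flip : ∀ 𝑴 {w x y z} → Hit 𝑴 w x y z → Hit 𝑴 w z y x
  hit-flip 𝑴 = hit-turn 𝑴 ∘ hit-mirror 𝑴

  module Missed (𝑴 : Matching) where
    open Matching 𝑴

    module _ {v x y z : V} (Q : Square v x y z) (missed : ¬ Hit 𝑴 v x y z) where
      open Square Q renaming (wx to vx; zw to zv; w≢y to v≢y)

      Mv≢x : M v ≢ x
      Mv≢x = missed ∘ inj₁

      Mv≢z : M v ≢ z
      Mv≢z = missed ∘ inj₂ ∘ inj₂ ∘ inj₂ ∘ M-sym

      nbrs : Nbrs v x z (M v)
      nbrs with third vx (~-sym zv) x≢z
      ... | d , N with Nbrs.exhaust N (M-adj v)
      ...   | inj₁ e        = contradiction e Mv≢x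
      ...   | inj₂ (inj₁ e) = contradiction e Mv≢z
      ...   | inj₂ (inj₂ refl) = N

    missed-turn : ∀ {v x y z} → ¬ Hit 𝑴 v x y z → ¬ Hit 𝑴 x y z v
    missed-turn h = h ∘ hit-turn 𝑴 ∘ hit-turn 𝑴 ∘ hit-turn 𝑴

    missed-mirror : ∀ {v x y z} → ¬ Hit 𝑴 v x y z → ¬ Hit 𝑴 x v z y
    missed-mirror h = h ∘ hit-mirror 𝑴

    missed-flip : ∀ {v x y z} → ¬ Hit 𝑴 v x y z → ¬ Hit 𝑴 v z y x
    missed-flip h = h ∘ hit-flip 𝑴 ∘ hit-flip 𝑴 ∘ hit-flip 𝑴

    Mv≁y : ∀ {v x y z} → Square v x y z → ¬ Hit 𝑴 v x y z → ¬ (y ~ M v)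
    Mv≁y Q missed a with Nbrs.exhaust (nbrs (turn (turn Q)) (missed-turn (missed-turn missed))) a
    ... | inj₁ e        = Mv≢z Q missed e
    ... | inj₂ (inj₁ e) = Mv≢x Q missed e
    ... | inj₂ (inj₂ e) = Square.w≢y Q (trans (sym (M-invol _)) (trans (cong M e) (M-invol _)))

    -- `S` uses two of the three edges at `v`. If these were the edges to `x` and `z`, the fourth
    -- vertex `r` would be `y`, making `S` the missed square `Q`, or else `M x`; the latter, being
    -- adjacent to `z`, would force `M x` to be `y` or `M z`, both impossible. So `S` contains `M v`
    -- and, say, `x`. As `y` is not adjacent to `M v`, the fourth vertex is `M x`, and `S`
    -- alternates.
    alternating : ∀ {v x y z a r b} → Square v x y z → ¬ Hit 𝑴 v x y z → Square v a r b → Hit 𝑴 v a r b →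
      M v ~ M x ⊎ M v ~ M z
    alternating {v} {x} {y} {z} {a} {r} {b} Q missed S hit =
      cases (Nbrs.exhaust N (Square.wx S)) (Nbrs.exhaust N (~-sym (Square.zw S)))
      where
      N = nbrs Q missed
      sideA : ∀ {x y z a r b} → Square v x y z → ¬ Hit 𝑴 v x y z → Square v a r b → a ≡ x → b ≡ M v → M v ~ M x
      sideA Q h S refl refl with Nbrs.exhaust (nbrs (mirror Q) (missed-mirror h)) (Square.xy S)
      ... | inj₁ e           = contradiction (sym e) (Square.w≢y S)
      ... | inj₂ (inj₁ refl) = contradiction (Square.yz S) (Mv≁y Q h)
      ... | inj₂ (inj₂ refl) = ~-sym (Square.yz S)
      sideB : ∀ {a r b} → Square v a r b → Hit 𝑴 v a r b → a ≡ x → b ≡ z → ⊥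
      sideB S hit refl refl with Nbrs.exhaust (nbrs (mirror Q) (missed-mirror missed)) (Square.xy S)
      ... | inj₁ e           = Square.w≢y S (sym e)
      ... | inj₂ (inj₁ refl) = missed hit
      ... | inj₂ (inj₂ refl)
        with Nbrs.exhaust (nbrs (mirror (flip-square Q)) (missed-mirror (missed-flip missed))) (~-sym (Square.yz S))
      ...   | inj₁ e        = Square.w≢y S (sym e)
      ...   | inj₂ (inj₁ e) = missed (inj₂ (inj₁ e))
      ...   | inj₂ (inj₂ e) = Square.x≢z S (trans (sym (M-invol _)) (trans (cong M e) (M-invol _)))
      cases : a ≡ x ⊎ a ≡ z ⊎ a ≡ M v → b ≡ x ⊎ b ≡ z ⊎ b ≡ M v → M v ~ M x ⊎ M v ~ M z
      cases (inj₁ p) (inj₁ q)               = contradiction (trans p (sym q)) (Square.x≢z S)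
      cases (inj₁ p) (inj₂ (inj₁ q))        = ⊥-elim (sideB S hit p q)
      cases (inj₁ p) (inj₂ (inj₂ q))        = inj₁ (sideA Q missed S p q)
      cases (inj₂ (inj₁ p)) (inj₁ q)        = ⊥-elim (sideB (flip-square S) (hit-flip 𝑴 hit) q p)
      cases (inj₂ (inj₁ p)) (inj₂ (inj₁ q)) = contradiction (trans p (sym q)) (Square.x≢z S)
      cases (inj₂ (inj₁ p)) (inj₂ (inj₂ q)) = inj₂ (sideA (flip-square Q) (missed-flip missed) S p q)
      cases (inj₂ (inj₂ p)) (inj₁ q)        = inj₁ (sideA Q missed (flip-square S) q p)
      cases (inj₂ (inj₂ p)) (inj₂ (inj₁ q)) = inj₂ (sideA (flip-square Q) (missed-flip missed) (flip-square S) q p)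
      cases (inj₂ (inj₂ p)) (inj₂ (inj₂ q)) = contradiction (trans p (sym q)) (Square.x≢z S)

    -- The switch removes the edge at `M v` from this square, whose other neighbour `w₄` of `v` is
    -- `x` or `z`. If `x`, the new edge `v x` hits it. If `z`, then `w₃` is `M z`, because `y` is
    -- not adjacent to `M v`; the edge from `z` to `M z` is untouched by the switch.
    switched-hit : ∀ {v x y z} → Square v x y z → ¬ Hit 𝑴 v x y z → M v ~ M x →
      (𝑴′ : Matching) → let M′ = Matching.M 𝑴′ in M′ v ≡ x →
      (∀ u → u ≢ v → u ≢ x → u ≢ M v → u ≢ M x → M′ u ≡ M u) →
      ∀ {w₂ w₃ w₄} → Square v w₂ w₃ w₄ → M v ≡ w₂ → Hit 𝑴′ v w₂ w₃ w₄
    switched-hit {v} {x} {y} {z} Q missed st 𝑴′ at-v else-M {w₂} {w₃} {w₄} S refl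
      with Nbrs.exhaust (nbrs Q missed) (~-sym (Square.zw S))
    ... | inj₁ refl = inj₂ (inj₂ (inj₂ (Matching.M-sym 𝑴′ at-v)))
    ... | inj₂ (inj₂ e) = contradiction (sym e) (Square.x≢z S)
    ... | inj₂ (inj₁ refl)
      with Nbrs.exhaust (nbrs (mirror (flip-square Q)) (missed-mirror (missed-flip missed))) (~-sym (Square.yz S))
    ...   | inj₁ e           = contradiction (sym e) (Square.w≢y S)
    ...   | inj₂ (inj₁ refl) = contradiction (~-sym (Square.xy S)) (Mv≁y Q missed)
    ...   | inj₂ (inj₂ refl) = inj₂ (inj₂ (inj₁ (Matching.M-sym 𝑴′
              (else-M w₄ (~⇒≢ (Square.zw Q)) (Square.x≢z Q ∘ sym) (Mv≢z Q missed ∘ sym) z≢Mx))))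
      where
      z≢Mx : z ≢ M x
      -- `x` and `z` have the same colour, `x` and `M x` different ones.
      z≢Mx refl = bip x (M x) (M-adj x)
        (≢⇒≡ (bip _ _ (~-sym (Square.wx Q))) (bip _ _ (Square.zw Q)))

    -- Only squares through one of the two removed edges are in danger. `switched-hit` handles the
    -- edge at `v` and, with `v` and `x` exchanged by `mirror`, the edge at `x`.
    switch : ∀ {v x y z} → Square v x y z → ¬ Hit 𝑴 v x y z → M v ~ M x → ∃ λ 𝑴′ →
      Hit 𝑴′ v x y z × (∀ {w₁ w₂ w₃ w₄} → Square w₁ w₂ w₃ w₄ → Hit 𝑴 w₁ w₂ w₃ w₄ → Hit 𝑴′ w₁ w₂ w₃ w₄)
    switch {v} {x} {y} {z} Q missed st = 𝑴′ , inj₁ at-v , keep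
      where
      s = M v
      t = M x
      x≢v : x ≢ v
      x≢v = ~⇒≢ (Square.wx Q) ∘ sym
      s≢v : s ≢ v
      s≢v = ~⇒≢ (M-adj v) ∘ sym
      s≢x : s ≢ x
      s≢x = Mv≢x Q missed
      t≢v : t ≢ v
      t≢v e = s≢x (M-sym e)
      t≢x : t ≢ x
      t≢x = ~⇒≢ (M-adj x) ∘ sym
      t≢s : t ≢ s
      t≢s = ~⇒≢ st ∘ sym
      M′ : V → V
      M′ u = if u == v then x else if u == x then v else if u == s then t else if u == t then s else M u
      at-v : M′ v ≡ x
      at-v rewrite ==-yes {x = v} refl = refl
      at-x : M′ x ≡ v
      at-x rewrite ==-no x≢v | ==-yes {x = x} refl = refl
      at-s : M′ s ≡ t
      at-s rewrite ==-no s≢v | ==-no s≢x | ==-yes {x = s} refl = refl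
      at-t : M′ t ≡ s
      at-t rewrite ==-no t≢v | ==-no t≢x | ==-no t≢s | ==-yes {x = t} refl = refl
      else-M : ∀ u → u ≢ v → u ≢ x → u ≢ s → u ≢ t → M′ u ≡ M u
      else-M u a b d e rewrite ==-no a | ==-no b | ==-no d | ==-no e = refl
      data View : V → Set where
        is-v : View v
        is-x : View x
        is-s : View s
        is-t : View t
        away : ∀ {u} → u ≢ v → u ≢ x → u ≢ s → u ≢ t → View u
      view : ∀ u → View u
      view u with u Fin.≟ v | u Fin.≟ x | u Fin.≟ s | u Fin.≟ t
      ... | yes refl | _ | _ | _ = is-v
      ... | no _ | yes refl | _ | _ = is-x
      ... | no _ | no _ | yes refl | _ = is-s
      ... | no _ | no _ | no _ | yes refl = is-t
      ... | no a | no b | no d | no e = away a b d e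
      M′-adj : ∀ u → u ~ M′ u
      M′-adj u with view u
      ... | is-v = subst (v ~_) (sym at-v) (Square.wx Q)
      ... | is-x = subst (x ~_) (sym at-x) (~-sym (Square.wx Q))
      ... | is-s = subst (s ~_) (sym at-s) st
      ... | is-t = subst (t ~_) (sym at-t) (~-sym st)
      ... | away a b d e = subst (u ~_) (sym (else-M u a b d e)) (M-adj u)
      M′-invol : ∀ u → M′ (M′ u) ≡ u
      M′-invol u with view u
      ... | is-v = trans (cong M′ at-v) at-x
      ... | is-x = trans (cong M′ at-x) at-v
      ... | is-s = trans (cong M′ at-s) at-t
      ... | is-t = trans (cong M′ at-t) at-s
      ... | away a b d e = trans (cong M′ (else-M u a b d e)) (trans (else-M (M u)
              (λ q → d (sym (M-sym q))) (λ q → e (sym (M-sym q)))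
              (λ q → a (trans (sym (M-invol u)) (trans (cong M q) (M-invol v))))
              (λ q → b (trans (sym (M-invol u)) (trans (cong M q) (M-invol x))))) (M-invol u))
      𝑴′ : Matching
      𝑴′ = record { M = M′ ; M-adj = M′-adj ; M-invol = M′-invol }
      keep-v : ∀ {w₂ w₃ w₄} → Square v w₂ w₃ w₄ → M v ≡ w₂ → Hit 𝑴′ v w₂ w₃ w₄
      keep-v = switched-hit Q missed st 𝑴′ at-v else-M
      keep-x : ∀ {w₂ w₃ w₄} → Square x w₂ w₃ w₄ → M x ≡ w₂ → Hit 𝑴′ x w₂ w₃ w₄
      keep-x = switched-hit (mirror Q) (missed-mirror missed) (~-sym st) 𝑴′ at-x
        λ u a b d e → else-M u b a e d
      keep-edge : ∀ {w₁ w₂ w₃ w₄} → Square w₁ w₂ w₃ w₄ → M w₁ ≡ w₂ → Hit 𝑴′ w₁ w₂ w₃ w₄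
      keep-edge {w₁} S e with view w₁
      ... | is-v = keep-v S e
      ... | is-x = keep-x S e
      ... | away a b d f = inj₁ (trans (else-M w₁ a b d f) e)
      keep-edge S e | is-s with refl ← trans (sym e) (M-invol v) = hit-mirror 𝑴′ (keep-v (mirror S) refl)
      keep-edge S e | is-t with refl ← trans (sym e) (M-invol x) = hit-mirror 𝑴′ (keep-x (mirror S) refl)
      unturn : ∀ {w₁ w₂ w₃ w₄} → Hit 𝑴′ w₂ w₃ w₄ w₁ → Hit 𝑴′ w₁ w₂ w₃ w₄
      unturn = hit-turn 𝑴′ ∘ hit-turn 𝑴′ ∘ hit-turn 𝑴′
      keep : ∀ {w₁ w₂ w₃ w₄} → Square w₁ w₂ w₃ w₄ → Hit 𝑴 w₁ w₂ w₃ w₄ → Hit 𝑴′ w₁ w₂ w₃ w₄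
      keep S (inj₁ e)               = keep-edge S e
      keep S (inj₂ (inj₁ e))        = unturn (keep-edge (turn S) e)
      keep S (inj₂ (inj₂ (inj₁ e))) = unturn (unturn (keep-edge (turn (turn S)) e))
      keep S (inj₂ (inj₂ (inj₂ e))) = unturn (unturn (unturn (keep-edge (turn (turn (turn S))) e)))

  -- A perfect matching that meets every 4-cycle

  module _ (F : Family) where
    open Family F

    family-square : ∀ {u} → o u ≢ u → Square u (p u) (o u) (o (p u))
    family-square {u} h = mkSquare (adj-p h)
        (~-sym (subst (o u ~_) (p-o u) (adj-p h′)))
        (subst (λ w → o u ~ o w) (p-o u) (adj-op h′))
        (~-sym (adj-op h)) (h ∘ sym) (p-in h ∘ sym)
      where
      h′ : o (o u) ≢ o u
      h′ e = h (trans (sym e) (o-invol u))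

    HitsFamily : Matching → Set
    HitsFamily 𝑴 = ∀ {u} → o u ≢ u → Hit 𝑴 u (p u) (o u) (o (p u))

    initial : ∃ HitsFamily
    initial with 𝑴 , hits ← Contraction.matching c bip F = 𝑴 , λ {u} h → convert 𝑴 h (hits u)
      where
      convert : ∀ 𝑴 {u} → o u ≢ u → let open Matching 𝑴 in
        (M u ≡ p u ⊎ M u ≡ o (p u)) ⊎ (M (o u) ≡ p u ⊎ M (o u) ≡ o (p u)) ⊎ o u ≡ u →
        Hit 𝑴 u (p u) (o u) (o (p u))
      convert 𝑴 h (inj₁ (inj₁ e))        = inj₁ e
      convert 𝑴 h (inj₁ (inj₂ e))        = inj₂ (inj₂ (inj₂ (Matching.M-sym 𝑴 e)))
      convert 𝑴 h (inj₂ (inj₁ (inj₁ e))) = inj₂ (inj₁ (Matching.M-sym 𝑴 e))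
      convert 𝑴 h (inj₂ (inj₁ (inj₂ e))) = inj₂ (inj₂ (inj₁ e))
      convert 𝑴 h (inj₂ (inj₂ e))        = contradiction e h

    Improves : Matching → (w x y z : V) → Set
    Improves 𝑴 w x y z = ∃ λ 𝑴′ → Hit 𝑴′ w x y z ×
      (∀ {w₁ w₂ w₃ w₄} → Square w₁ w₂ w₃ w₄ → Hit 𝑴 w₁ w₂ w₃ w₄ → Hit 𝑴′ w₁ w₂ w₃ w₄)

    improve-at : ∀ 𝑴 → HitsFamily 𝑴 → ∀ {w x y z} → Square w x y z → ¬ Hit 𝑴 w x y z → o w ≢ w →
      Improves 𝑴 w x y z
    improve-at 𝑴 hf Q missed h with Missed.alternating 𝑴 Q missed (family-square h) (hf h)
    ... | inj₁ a = Missed.switch 𝑴 Q missed a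
    ... | inj₂ a with 𝑴′ , hit , keep ← Missed.switch 𝑴 (flip-square Q) (Missed.missed-flip 𝑴 missed) a =
      𝑴′ , hit-flip 𝑴′ hit , keep

    improve-turned : ∀ 𝑴 {w x y z} → Improves 𝑴 x y z w → Improves 𝑴 w x y z
    improve-turned _ (𝑴′ , hit , keep) = 𝑴′ , hit-turn 𝑴′ (hit-turn 𝑴′ (hit-turn 𝑴′ hit)) , keep

    improve : ∀ 𝑴 → HitsFamily 𝑴 → ∀ {w x y z} → Square w x y z → ¬ Hit 𝑴 w x y z → Meets F w x y z →
      Improves 𝑴 w x y z
    improve 𝑴 hf Q missed m = by-vertex m
      where
      open Missed 𝑴 using (missed-turn)
      by-vertex : Meets F _ _ _ _ → Improves 𝑴 _ _ _ _
      by-vertex (inj₁ h)               = improve-at 𝑴 hf Q missed h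
      by-vertex (inj₂ (inj₁ h))        = improve-turned 𝑴 (improve-at 𝑴 hf (turn Q) (missed-turn missed) h)
      by-vertex (inj₂ (inj₂ (inj₁ h))) = improve-turned 𝑴 (improve-turned 𝑴
        (improve-at 𝑴 hf (turn (turn Q)) (missed-turn (missed-turn missed)) h))
      by-vertex (inj₂ (inj₂ (inj₂ h))) = improve-turned 𝑴 (improve-turned 𝑴 (improve-turned 𝑴
        (improve-at 𝑴 hf (turn (turn (turn Q))) (missed-turn (missed-turn (missed-turn missed))) h)))

    -- `HitsFamily` is carried along because a switch needs a family member through the missed
    -- square that the matching meets. Switches lose no hit square, hence no member of the family.
    improve-all : (∀ {w x y z} → Square w x y z → Meets F w x y z) →
      ∀ qs → ∃ λ 𝑴 → HitsFamily 𝑴 × (∀ {w x y z} → (w , x , y , z) ∈ qs → Square w x y z → Hit 𝑴 w x y z)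
    improve-all meets [] with 𝑴 , hf ← initial = 𝑴 , hf , λ ()
    improve-all meets ((w , x , y , z) ∷ qs) with 𝑴 , hf , hits ← improve-all meets qs
      with square? w x y z | hit? 𝑴 w x y z
    ... | no ¬S | _     = 𝑴 , hf , λ { (here refl) S → contradiction S ¬S ; (there m) S → hits m S }
    ... | yes _ | yes h = 𝑴 , hf , λ { (here refl) S → h ; (there m) S → hits m S }
    ... | yes S | no missed with 𝑴′ , h , keep ← improve 𝑴 hf S missed (meets S) =
      𝑴′ , (λ u-in → keep (family-square u-in) (hf u-in)) ,
      λ { (here refl) _ → h ; (there m) S′ → keep S′ (hits m S′) }

  abstract
    square-free-complement : ∃ λ 𝑴 → ∀ {w x y z} → Square w x y z → Hit 𝑴 w x y z
    square-free-complement =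
      let F , meets   = maximal-family
          𝑴 , _ , hit = improve-all F meets quads
      in 𝑴 , λ S → hit (∈-quads _) S

-- The complementary 2-factor and its orientation

module TwoFactor {n : ℕ} (G : Graph n) (cubic : Cubic G)
  (c : Fin n → Bool) (bip : ∀ u v → Adj G u v → c u ≢ c v) where
  open CubicGraph G cubic
  open Squares G cubic c bip

  -- A 2-factor without 4-cycles, traversed by π; the perfect matching m is its complement.
  record Traversal : Set where
    field
      m π π⁻  : V → V
      m-invol : ∀ u → m (m u) ≡ u
      π-π⁻    : ∀ u → π (π⁻ u) ≡ u
      π⁻-π    : ∀ u → π⁻ (π u) ≡ u
      π-adj   : ∀ u → u ~ π u
      exhaust : ∀ {u v} → u ~ v → v ≡ m u ⊎ v ≡ π u ⊎ v ≡ π⁻ u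
      no-4    : ∀ u → π (π (π (π u))) ≢ u

  module _ (𝑴 : Matching) where
    open Matching 𝑴

    private
      W : V → V → ℕ
      W x y = 𝟙 (adj G x y ∧ not (M x == y))

      W-sym : ∀ x y → W x y ≡ W y x
      W-sym x y = cong 𝟙 (cong₂ _∧_ (symm G x y) (cong not M-symm))
        where
        M-symm : (M x == y) ≡ (M y == x)
        M-symm with M x Fin.≟ y
        ... | yes e = sym (==-yes (M-sym e))
        ... | no h  = sym (==-no (h ∘ M-sym))

      W-rows : ∀ x → sum (W x) ≡ 2
      W-rows x with b , d , N ← with-first (M-adj x) =
        trans (sum-neighbours N (λ y → not (M x == y))) count
        where
        count : 𝟙 (not (M x == M x)) + (𝟙 (not (M x == b)) + 𝟙 (not (M x == d))) ≡ 2
        count rewrite ==-yes {x = M x} refl | ==-no (Nbrs.a≢b N) | ==-no (Nbrs.a≢d N) = refl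

      W-edge : ∀ x y → 0 < W x y → x ~ y × M x ≢ y
      W-edge x y h with a , b ← ∧-true {adj G x y} (𝟙-positive h) = a , λ e → absurd (trans (sym b) (cong not (==-yes e)))
        where
        absurd : true ≢ false
        absurd ()

    second-matching : ∃ λ 𝑴₂ → ∀ x → M x ≢ Matching.M 𝑴₂ x
    second-matching
      with m , pos , invol ← perfect-matching W 1 W-sym W-rows c (λ x y → bip x y ∘ proj₁ ∘ W-edge x y) =
        record { M = m ; M-adj = λ u → proj₁ (W-edge u (m u) (pos u)) ; M-invol = invol }
        , λ u → proj₂ (W-edge u (m u) (pos u))

  module _ (𝑴 𝑴₂ : Matching) (distinct : ∀ x → Matching.M 𝑴 x ≢ Matching.M 𝑴₂ x) where
    open Matching 𝑴
    open Matching 𝑴₂ renaming (M to M₂; M-adj to M₂-adj; M-invol to M₂-invol; M-sym to M₂-sym)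

    third-matching : ∃ λ 𝑴₃ → ∀ x → Nbrs x (M x) (M₂ x) (Matching.M 𝑴₃ x)
    third-matching = record { M = M₃ ; M-adj = Nbrs.~d ∘ nbrs ; M-invol = invol } , nbrs
      where
      M₃ : V → V
      M₃ x = proj₁ (third (M-adj x) (M₂-adj x) (distinct x))
      nbrs : ∀ x → Nbrs x (M x) (M₂ x) (M₃ x)
      nbrs x = proj₂ (third (M-adj x) (M₂-adj x) (distinct x))
      invol : ∀ x → M₃ (M₃ x) ≡ x
      invol x with Nbrs.exhaust (nbrs (M₃ x)) (~-sym (Nbrs.~d (nbrs x)))
      ... | inj₁ e        = contradiction (M-sym (sym e)) (Nbrs.a≢d (nbrs x))
      ... | inj₂ (inj₁ e) = contradiction (M₂-sym (sym e)) (Nbrs.b≢d (nbrs x))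
      ... | inj₂ (inj₂ e) = sym e

  module Colours (𝑴 𝑴₂ 𝑴₃ : Matching)
    (nbrs : ∀ x → Nbrs x (Matching.M 𝑴 x) (Matching.M 𝑴₂ x) (Matching.M 𝑴₃ x))
    (hits : ∀ {w x y z} → Square w x y z → Hit 𝑴 w x y z) where
    open Matching 𝑴
    open Matching 𝑴₂ renaming (M to M₂; M-adj to M₂-adj; M-invol to M₂-invol; M-sym to M₂-sym)
    open Matching 𝑴₃ renaming (M to M₃; M-adj to M₃-adj; M-invol to M₃-invol; M-sym to M₃-sym)

    -- Along a cycle of the 2-factor both the matchings `M₂`, `M₃` and the colours of the vertices
    -- alternate. Leaving `true` vertices by `M₂` and `false` ones by `M₃` therefore goes around
    -- each cycle in one direction.
    π π⁻ : V → V
    π u = if c u then M₂ u else M₃ u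
    π⁻ u = if c u then M₃ u else M₂ u

    π-adj : ∀ u → u ~ π u
    π-adj u with c u
    ... | true  = M₂-adj u
    ... | false = M₃-adj u

    true-or-false : ∀ b → b ≡ true ⊎ b ≡ false
    true-or-false true  = inj₁ refl
    true-or-false false = inj₂ refl

    opposite : ∀ {u v b} → u ~ v → c u ≡ b → c v ≡ not b
    opposite {u} {v} a refl with c u | c v | bip u v a
    ... | true  | true  | h = contradiction refl h
    ... | true  | false | _ = refl
    ... | false | true  | _ = refl
    ... | false | false | h = contradiction refl h

    π-true : ∀ {u} → c u ≡ true → π u ≡ M₂ u
    π-true e rewrite e = refl
    π-false : ∀ {u} → c u ≡ false → π u ≡ M₃ u
    π-false e rewrite e = refl
    π⁻-true : ∀ {u} → c u ≡ true → π⁻ u ≡ M₃ u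
    π⁻-true e rewrite e = refl
    π⁻-false : ∀ {u} → c u ≡ false → π⁻ u ≡ M₂ u
    π⁻-false e rewrite e = refl

    π-π⁻ : ∀ u → π (π⁻ u) ≡ u
    π-π⁻ u with true-or-false (c u)
    ... | inj₁ e = trans (cong π (π⁻-true e)) (trans (π-false (opposite (M₃-adj u) e)) (M₃-invol u))
    ... | inj₂ e = trans (cong π (π⁻-false e)) (trans (π-true (opposite (M₂-adj u) e)) (M₂-invol u))

    π⁻-π : ∀ u → π⁻ (π u) ≡ u
    π⁻-π u with true-or-false (c u)
    ... | inj₁ e = trans (cong π⁻ (π-true e)) (trans (π⁻-false (opposite (M₂-adj u) e)) (M₂-invol u))
    ... | inj₂ e = trans (cong π⁻ (π-false e)) (trans (π⁻-true (opposite (M₃-adj u) e)) (M₃-invol u))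

    M≢π : ∀ u → M u ≢ π u
    M≢π u with c u
    ... | true  = Nbrs.a≢b (nbrs u)
    ... | false = Nbrs.a≢d (nbrs u)

    π≢π⁻ : ∀ u → π u ≢ π⁻ u
    π≢π⁻ u with c u
    ... | true  = Nbrs.b≢d (nbrs u)
    ... | false = Nbrs.b≢d (nbrs u) ∘ sym

    exhaust : ∀ {u v} → u ~ v → v ≡ M u ⊎ v ≡ π u ⊎ v ≡ π⁻ u
    exhaust {u} a with c u
    ... | true  = Nbrs.exhaust (nbrs u) a
    ... | false = Nbrs.exhaust (swap₂₃ (nbrs u)) a

    ππ≢ : ∀ u → π (π u) ≢ u
    ππ≢ u e = π≢π⁻ (π u) (trans e (sym (π⁻-π u)))

    -- Such an orbit is a 4-cycle, so `M` contains one of its edges; but `π` never follows `M`.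
    no-4 : ∀ u → π (π (π (π u))) ≢ u
    no-4 u e with hits {u} {π u} {π (π u)} {π (π (π u))}
      (mkSquare (π-adj _) (π-adj _) (π-adj _) (subst (π (π (π u)) ~_) e (π-adj _)) (ππ≢ u ∘ sym) (ππ≢ (π u) ∘ sym))
    ... | inj₁ h               = M≢π _ h
    ... | inj₂ (inj₁ h)        = M≢π _ h
    ... | inj₂ (inj₂ (inj₁ h)) = M≢π _ h
    ... | inj₂ (inj₂ (inj₂ h)) = M≢π _ (trans h (sym e))

    traversal : Traversal
    traversal = record { m = M ; π = π ; π⁻ = π⁻ ; m-invol = M-invol ; π-π⁻ = π-π⁻ ; π⁻-π = π⁻-π
      ; π-adj = π-adj ; exhaust = exhaust ; no-4 = no-4 }

  abstract
    traversal : Traversal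
    traversal =
      let 𝑴  , hits     = square-free-complement
          𝑴₂ , distinct = second-matching 𝑴
          𝑴₃ , nbrs     = third-matching 𝑴 𝑴₂ distinct
      in Colours.traversal 𝑴 𝑴₂ 𝑴₃ nbrs hits

-- Positions without chords

-- C i says that the path of order 4 starting at position i of a cycle is spanned by a chord.
module _ (C : ℕ → Set) (skip : ∀ i → C i → ¬ C (3 + i)) where

  private
    fst-out : ∀ {A B : Set} → A ⊎ B → ¬ A → B
    fst-out (inj₁ a) ¬a = contradiction a ¬a
    fst-out (inj₂ b) _  = b

    snd-out : ∀ {A B : Set} → A ⊎ B → ¬ B → A
    snd-out (inj₁ a) _  = a
    snd-out (inj₂ b) ¬b = contradiction b ¬b

  -- From 1 the chords are forced, alternately by `skip` and `pair`: 4 is excluded, so 0 and 8 hold;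
  -- these exclude 3 and 5, so 7 and 9 hold; 9 excludes 6, so 10 holds, against 7.
  chord-propagation : (∀ i → i < 7 → C i ⊎ C (4 + i)) → ¬ C 1
  chord-propagation pair c₁ = skip 7 c₇ c₁₀
    where
    lt : ∀ {i j} → i + j < 7 → i < 7
    lt = ℕ.≤-<-trans (ℕ.m≤m+n _ _)
    c₄ : ¬ C 4
    c₄ = skip 1 c₁
    c₈ : C 8
    c₈ = fst-out (pair 4 (lt {j = 2} ℕ.≤-refl)) c₄
    c₀ : C 0
    c₀ = snd-out (pair 0 z<s) c₄
    c₉ : C 9
    c₉ = fst-out (pair 5 (lt {j = 1} ℕ.≤-refl)) λ c₅ → skip 5 c₅ c₈
    c₁₀ : C 10
    c₁₀ = fst-out (pair 6 ℕ.≤-refl) λ c₆ → skip 6 c₆ c₉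
    c₇ : C 7
    c₇ = fst-out (pair 3 (lt {j = 3} ℕ.≤-refl)) (skip 0 c₀)

-- If every pair failed, the one at 1 would give `C 1` or `C 5`, and the second is the first for the
-- sequence shifted by 4. The propagation uses pairs up to 6, so up to 10 after the shift: hence the
-- search bound 11.
chord-free-pair : (C : ℕ → Set) → (∀ i → Dec (C i)) → (∀ i → C i → ¬ C (3 + i)) →
  ∃ λ i → ¬ C i × ¬ C (4 + i)
chord-free-pair C C? skip with ℕ.anyUpTo? (λ i → ¬? (C? i) ×-dec ¬? (C? (4 + i))) 11
... | yes (i , _ , p) = i , p
... | no none = ⊥-elim (start (pair 1 (s≤s (s≤s z≤n))))
  where
  pair : ∀ i → i < 11 → C i ⊎ C (4 + i)
  pair i i<11 with C? i | C? (4 + i)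
  ... | yes a | _     = inj₁ a
  ... | no _  | yes b = inj₂ b
  ... | no a  | no b  = contradiction (i , i<11 , a , b) none
  start : C 1 ⊎ C 5 → ⊥
  start (inj₁ c₁) = chord-propagation C skip (λ i i<7 → pair i (ℕ.<-≤-trans i<7 (ℕ.m≤m+n 7 4))) c₁
  start (inj₂ c₅) = chord-propagation (C ∘ (4 +_)) (λ i → skip (4 + i)) (λ i i<7 → pair (4 + i) (ℕ.+-monoʳ-< 4 i<7)) c₅

-- Cutting the cycles into induced paths

module Decomposition {n : ℕ} (G : Graph n) (cubic : Cubic G)
  (c : Fin n → Bool) (bip : ∀ u v → Adj G u v → c u ≢ c v) (T : TwoFactor.Traversal G cubic c bip) where
  open CubicGraph G cubic
  open TwoFactor.Traversal T

  c-two : ∀ u → c (π (π u)) ≡ c u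
  c-two u = ≢⇒≡ (bip _ _ (π-adj (π u)) ∘ sym) (bip _ _ (π-adj u))

  same-colour : ∀ {u v} → c u ≡ c v → ¬ (u ~ v)
  same-colour e a = bip _ _ a e

  no-2 : ∀ u → π (π u) ≢ u
  no-2 u e = no-4 u (trans (cong (π ∘ π) e) e)

  no-5 : ∀ u → π (π (π (π (π u)))) ≢ u
  no-5 u e = bip _ _ (π-adj _) (trans (trans (c-two _) (c-two u)) (cong c (sym e)))

  Chord : V → Set
  Chord u = m u ≡ π (π (π u))

  -- Two such chords would match the vertex three steps after `u` both to `u` and to the vertex six
  -- steps after `u`.
  chord-skip : ∀ {u} → π (π (π (π (π (π u))))) ≢ u → Chord u → ¬ Chord (π (π (π u)))
  chord-skip {u} no-6 h h′ = no-6 (trans (sym h′) (trans (cong m (sym h)) (m-invol u)))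

  end-non-adjacent : ∀ {u} → ¬ Chord u → ¬ (u ~ π (π (π u)))
  end-non-adjacent {u} h a with exhaust a
  ... | inj₁ e        = h (sym e)
  ... | inj₂ (inj₁ e) = no-2 (π u) e
  ... | inj₂ (inj₂ e) = no-4 u (trans (cong π e) (π-π⁻ u))

  private
    edge : ∀ {A B : Set} → A → B → A ⇔ B
    edge a b = mk⇔ (λ _ → b) (λ _ → a)

    non-edge : ∀ {A B : Set} → ¬ A → ¬ B → A ⇔ B
    non-edge ¬a ¬b = mk⇔ (λ a → contradiction a ¬a) (λ b → contradiction b ¬b)

    loop : ∀ {u} → ¬ (u ~ u)
    loop a = ~⇒≢ a refl

  induced-P₃ : ∀ u → InducedPath G (u ∷ π u ∷ π (π u) ∷ [])
  induced-P₃ u zero zero                         = non-edge loop λ { (inj₁ ()) ; (inj₂ ()) }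
  induced-P₃ u zero (suc zero)                   = edge (π-adj u) (inj₁ refl)
  induced-P₃ u zero (suc (suc zero))             = non-edge (same-colour (sym (c-two u))) λ { (inj₁ ()) ; (inj₂ ()) }
  induced-P₃ u (suc zero) zero                   = edge (~-sym (π-adj u)) (inj₂ refl)
  induced-P₃ u (suc zero) (suc zero)             = non-edge loop λ { (inj₁ ()) ; (inj₂ ()) }
  induced-P₃ u (suc zero) (suc (suc zero))       = edge (π-adj _) (inj₁ refl)
  induced-P₃ u (suc (suc zero)) zero             = non-edge (same-colour (c-two u)) λ { (inj₁ ()) ; (inj₂ ()) }
  induced-P₃ u (suc (suc zero)) (suc zero)       = edge (~-sym (π-adj _)) (inj₂ refl)
  induced-P₃ u (suc (suc zero)) (suc (suc zero)) = non-edge loop λ { (inj₁ ()) ; (inj₂ ()) }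

  induced-P₄ : ∀ {u} → ¬ Chord u → InducedPath G (u ∷ π u ∷ π (π u) ∷ π (π (π u)) ∷ [])
  induced-P₄ h zero zero                         = non-edge loop λ { (inj₁ ()) ; (inj₂ ()) }
  induced-P₄ h zero (suc zero)                   = edge (π-adj _) (inj₁ refl)
  induced-P₄ h zero (suc (suc zero))             = non-edge (same-colour (sym (c-two _))) λ { (inj₁ ()) ; (inj₂ ()) }
  induced-P₄ h zero (suc (suc (suc zero)))       = non-edge (end-non-adjacent h) λ { (inj₁ ()) ; (inj₂ ()) }
  induced-P₄ h (suc (suc (suc zero))) zero       = non-edge (end-non-adjacent h ∘ ~-sym) λ { (inj₁ ()) ; (inj₂ ()) }
  induced-P₄ h (suc zero) zero                   = edge (~-sym (π-adj _)) (inj₂ refl)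
  induced-P₄ h (suc zero) (suc zero)             = non-edge loop λ { (inj₁ ()) ; (inj₂ ()) }
  induced-P₄ h (suc zero) (suc (suc zero))       = edge (π-adj _) (inj₁ refl)
  induced-P₄ h (suc zero) (suc (suc (suc zero))) = non-edge (same-colour (sym (c-two _))) λ { (inj₁ ()) ; (inj₂ ()) }
  induced-P₄ h (suc (suc zero)) zero             = non-edge (same-colour (c-two _)) λ { (inj₁ ()) ; (inj₂ ()) }
  induced-P₄ h (suc (suc zero)) (suc zero)       = edge (~-sym (π-adj _)) (inj₂ refl)
  induced-P₄ h (suc (suc zero)) (suc (suc zero)) = non-edge loop λ { (inj₁ ()) ; (inj₂ ()) }
  induced-P₄ h (suc (suc zero)) (suc (suc (suc zero)))       = edge (π-adj _) (inj₁ refl)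
  induced-P₄ h (suc (suc (suc zero))) (suc zero)             = non-edge (same-colour (c-two _)) λ { (inj₁ ()) ; (inj₂ ()) }
  induced-P₄ h (suc (suc (suc zero))) (suc (suc zero))       = edge (~-sym (π-adj _)) (inj₂ refl)
  induced-P₄ h (suc (suc (suc zero))) (suc (suc (suc zero))) = non-edge loop λ { (inj₁ ()) ; (inj₂ ()) }

  -- Order at least 3, more than an IPD asks for: this yields the bound on the number of paths.
  Good : List V → Set
  Good p = InducedPath G p × 3 ≤ length p

  π^ : ℕ → V → V
  π^ zero    u = u
  π^ (suc i) u = π (π^ i u)

  π^-+ : ∀ i j u → π^ (i + j) u ≡ π^ i (π^ j u)
  π^-+ zero    j u = refl
  π^-+ (suc i) j u = cong π (π^-+ i j u)

  π^-comm : ∀ i j u → π^ i (π^ j u) ≡ π^ j (π^ i u)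
  π^-comm i j u = trans (sym (π^-+ i j u)) (trans (cong (λ l → π^ l u) (ℕ.+-comm i j)) (π^-+ j i u))

  π-injective : ∀ {u v} → π u ≡ π v → u ≡ v
  π-injective {u} {v} e = trans (sym (π⁻-π u)) (trans (cong π⁻ e) (π⁻-π v))

  π^-injective : ∀ i {u v} → π^ i u ≡ π^ i v → u ≡ v
  π^-injective zero    e = e
  π^-injective (suc i) e = π^-injective i (π-injective e)

  triples : (ℕ → V) → ℕ → List (List V)
  triples f zero    = []
  triples f (suc q) = (f 0 ∷ f 1 ∷ f 2 ∷ []) ∷ triples (f ∘ (3 +_)) q

  concat-triples : ∀ f q → concat (triples f q) ≡ applyUpTo f (q * 3)
  concat-triples f zero    = refl
  concat-triples f (suc q) = cong (λ xs → f 0 ∷ f 1 ∷ f 2 ∷ xs) (concat-triples (f ∘ (3 +_)) q)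

  good-triples : ∀ f → (∀ i → f (suc i) ≡ π (f i)) → ∀ q → All Good (triples f q)
  good-triples f h zero    = []
  good-triples f h (suc q) = good ∷ good-triples (f ∘ (3 +_)) (h ∘ (3 +_)) q
    where
    good : Good (f 0 ∷ f 1 ∷ f 2 ∷ [])
    good rewrite h 1 | h 0 = induced-P₃ (f 0) , ℕ.≤-refl

  record Period (u : V) (k : ℕ) : Set where
    field
      positive : 0 < k
      returns  : π^ k u ≡ u
      first    : ∀ {i} → 0 < i → i < k → π^ i u ≢ u

  period-shift : ∀ j {u k} → Period u k → Period (π^ j u) k
  period-shift j {u} {k} P = record
    { positive = positive
    ; returns  = trans (π^-comm k j u) (cong (π^ j) returns)
    ; first    = λ {i} 0<i i<k e → first 0<i i<k (π^-injective j (trans (π^-comm j i u) e)) }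
    where open Period P

  period : ∀ u → ∃ (Period u)
  period u = least (proj₁ some) (proj₂ some)
    where
    some : ∃ λ l → π^ (suc l) u ≡ u
    some with i , j , i<j , e ← Fin.pigeonhole (ℕ.n<1+n n) (λ i → π^ (toℕ i) u)
      with l , q ← ℕ.m≤n⇒∃[o]m+o≡n i<j =
      l , sym (π^-injective (toℕ i) (trans e (trans
        (cong (λ a → π^ a u) (trans (sym q) (sym (ℕ.+-suc (toℕ i) l)))) (π^-+ (toℕ i) (suc l) u))))
    none-below : ∀ l → (∃ (Period u)) ⊎ (∀ {i} → i < l → π^ (suc i) u ≢ u)
    none-below zero = inj₂ λ ()
    none-below (suc l) with none-below l
    ... | inj₁ P = inj₁ P
    ... | inj₂ h with π^ (suc l) u Fin.≟ u
    ...   | yes e = inj₁ (suc l , record { positive = z<s ; returns = e ; first = λ { {suc i} _ (s≤s i<l) → h i<l } })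
    ...   | no ne = inj₂ λ {i} i<sl → below i i<sl
      where
      below : ∀ i → i < suc l → π^ (suc i) u ≢ u
      below i (s≤s i≤l) with ℕ.m≤n⇒m<n∨m≡n i≤l
      ... | inj₁ i<l  = h i<l
      ... | inj₂ refl = ne
    least : ∀ l → π^ (suc l) u ≡ u → ∃ (Period u)
    least l e with none-below (suc l)
    ... | inj₁ P = P
    ... | inj₂ h = contradiction e (h (ℕ.n<1+n l))

  orbit : V → ℕ → List V
  orbit u k = applyUpTo (λ i → π^ i u) k

  orbit-unique : ∀ {u k} → Period u k → Unique (orbit u k)
  orbit-unique {u} {k} P = Unique.applyUpTo⁺₁ _ k distinct
    where
    open Period P
    distinct : ∀ {i j} → i < j → j < k → π^ i u ≢ π^ j u
    distinct {i} {j} i<j j<k e with l , refl ← ℕ.m≤n⇒∃[o]m+o≡n i<j =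
      first z<s (ℕ.≤-<-trans (s≤s (ℕ.m≤n+m l i)) j<k)
        (sym (π^-injective i (trans e (trans (cong (λ a → π^ a u) (sym (ℕ.+-suc i l))) (π^-+ i (suc l) u)))))

  orbit-π⁻ : ∀ {u k v} → Period u k → v ∈ orbit u k → π⁻ v ∈ orbit u k
  orbit-π⁻ {u} {k} P v∈ with ∈-applyUpTo⁻ (λ i → π^ i u) {n = k} v∈
  ... | suc i , i<k , refl = subst (_∈ orbit u k) (sym (π⁻-π _)) (∈-applyUpTo⁺ _ (ℕ.<-trans (ℕ.n<1+n i) i<k))
  orbit-π⁻ {u} {suc k} P v∈ | zero , _ , refl =
    subst (_∈ orbit u (suc k)) (trans (sym (π⁻-π _)) (cong π⁻ (Period.returns P))) (∈-applyUpTo⁺ (λ i → π^ i u) (ℕ.n<1+n k))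

  -- Closure under predecessors lets one walk back from `π^ i v` to `v` in `i` steps, without
  -- reference to a period.
  Closed : List V → Set
  Closed xs = ∀ {v} → v ∈ xs → π⁻ v ∈ xs

  closed-π^ : ∀ {xs} → Closed xs → ∀ i {v} → π^ i v ∈ xs → v ∈ xs
  closed-π^ cl zero    v∈ = v∈
  closed-π^ cl (suc i) v∈ = closed-π^ cl i (subst (_∈ _) (π⁻-π _) (cl v∈))

  Tiling : V → ℕ → Set
  Tiling w k = ∃ λ ps → concat ps ≡ orbit w k × All Good ps

  mod-3 : ∀ k → ∃ λ q → k ≡ q * 3 ⊎ k ≡ 1 + q * 3 ⊎ k ≡ 2 + q * 3
  mod-3 0 = 0 , inj₁ refl
  mod-3 1 = 0 , inj₂ (inj₁ refl)
  mod-3 2 = 0 , inj₂ (inj₂ refl)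
  mod-3 (suc (suc (suc k))) with mod-3 k
  ... | q , inj₁ refl        = suc q , inj₁ refl
  ... | q , inj₂ (inj₁ refl) = suc q , inj₂ (inj₁ refl)
  ... | q , inj₂ (inj₂ refl) = suc q , inj₂ (inj₂ refl)

  chord-skip-orbit : ∀ {u k} → Period u k → 6 < k → ∀ i → Chord (π^ i u) → ¬ Chord (π^ (3 + i) u)
  chord-skip-orbit P 6<k i = chord-skip (Period.first (period-shift i P) z<s 6<k)

  -- The starting point `j` is free, so that the paths of order 4 can be put where there is no
  -- chord. `chord-skip` needs length above 6; length 6 itself is cut into paths of order 3 only.
  tile-orbit : ∀ {u k} → Period u k → ∃ λ j → Tiling (π^ j u) k
  tile-orbit {u} {k} P with mod-3 k
  ... | q , inj₁ refl = 0 , triples f q , concat-triples f q , good-triples f (λ _ → refl) q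
    where f = λ i → π^ i u
  -- Lengths 1, 4, 2 and 5, too short for the cuts below, do not occur.
  ... | 0 , inj₂ (inj₁ refl) = contradiction (sym (Period.returns P)) (~⇒≢ (π-adj u))
  ... | 1 , inj₂ (inj₁ refl) = contradiction (Period.returns P) (no-4 u)
  ... | 0 , inj₂ (inj₂ refl) = contradiction (Period.returns P) (no-2 u)
  ... | 1 , inj₂ (inj₂ refl) = contradiction (Period.returns P) (no-5 u)
  ... | suc (suc q) , inj₂ (inj₁ refl) = start , ps start , eq start , good start (proj₂ found)
    where
    found : ∃ λ j → ¬ Chord (π^ j u)
    -- A chord at `u` excludes one three steps later.
    found with m u Fin.≟ π (π (π u))
    ... | no h  = 0 , h
    ... | yes h = 3 , chord-skip-orbit P (ℕ.m≤m+n 7 (q * 3)) 0 h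
    start = proj₁ found
    f : ℕ → ℕ → V
    f j i = π^ i (π^ j u)
    ps : ℕ → List (List V)
    ps j = (f j 0 ∷ f j 1 ∷ f j 2 ∷ f j 3 ∷ []) ∷ triples (f j ∘ (4 +_)) (suc q)
    eq : ∀ j → concat (ps j) ≡ orbit (π^ j u) (7 + q * 3)
    eq j = cong (λ xs → f j 0 ∷ f j 1 ∷ f j 2 ∷ f j 3 ∷ xs) (concat-triples (f j ∘ (4 +_)) (suc q))
    good : ∀ j → ¬ Chord (π^ j u) → All Good (ps j)
    good j h = (induced-P₄ h , ℕ.n≤1+n 3) ∷ good-triples (f j ∘ (4 +_)) (λ _ → refl) (suc q)
  ... | suc (suc q) , inj₂ (inj₂ refl) = start , ps start , eq start , good start (proj₂ found)
    where
    found : ∃ λ j → ¬ Chord (π^ j u) × ¬ Chord (π^ (4 + j) u)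
    found = chord-free-pair (λ i → Chord (π^ i u)) (λ i → m (π^ i u) Fin.≟ π^ (3 + i) u)
      (chord-skip-orbit P (ℕ.m≤m+n 7 (suc (q * 3))))
    start = proj₁ found
    f : ℕ → ℕ → V
    f j i = π^ i (π^ j u)
    ps : ℕ → List (List V)
    ps j = (f j 0 ∷ f j 1 ∷ f j 2 ∷ f j 3 ∷ []) ∷ (f j 4 ∷ f j 5 ∷ f j 6 ∷ f j 7 ∷ []) ∷ triples (f j ∘ (8 +_)) q
    eq : ∀ j → concat (ps j) ≡ orbit (π^ j u) (8 + q * 3)
    eq j = cong (λ xs → f j 0 ∷ f j 1 ∷ f j 2 ∷ f j 3 ∷ f j 4 ∷ f j 5 ∷ f j 6 ∷ f j 7 ∷ xs)
      (concat-triples (f j ∘ (8 +_)) q)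
    good : ∀ j → ¬ Chord (π^ j u) × ¬ Chord (π^ (4 + j) u) → All Good (ps j)
    good j (h , h′) = (induced-P₄ h , ℕ.n≤1+n 3) ∷ (induced-P₄ h′ , ℕ.n≤1+n 3) ∷
      good-triples (f j ∘ (8 +_)) (λ _ → refl) q

  open import Data.List.Membership.DecPropositional (Fin._≟_ {n}) using (_∈?_)

  record Partial (vs : List V) : Set where
    field
      paths  : List (List V)
      good   : All Good paths
      unique : Unique (concat paths)
      closed : Closed (concat paths)
      covers : ∀ {v} → v ∈ vs → v ∈ concat paths

  -- Whole orbits are added. If the orbit of an uncovered `v` met the covered set, walking back
  -- along `π⁻` would put `v` into it.
  partial : ∀ vs → Partial vs
  partial [] = record { paths = [] ; good = [] ; unique = [] ; closed = λ () ; covers = λ () }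
  partial (v ∷ vs) with partial vs
  ... | R with v ∈? concat (Partial.paths R)
  ...   | yes v∈ = record
    { paths = paths ; good = good ; unique = unique ; closed = closed
    ; covers = λ { (here refl) → v∈ ; (there x∈) → covers x∈ } }
    where open Partial R
  ...   | no v∉ = extend (tile-orbit (proj₂ (period v)))
    where
    open Partial R
    k = proj₁ (period v)
    extend : (∃ λ j → Tiling (π^ j v) k) → Partial (v ∷ vs)
    extend (j , ps , e , ok) = record
      { paths  = ps ++ paths
      ; good   = All.++⁺ ok good
      ; unique = subst Unique (sym split) (Unique.++⁺ (orbit-unique P) unique disjoint)
      ; closed = λ x∈ → subst (_ ∈_) (sym split) (closed′ (∈-++⁻ (orbit w k) (subst (_ ∈_) split x∈)))
      ; covers = λ { (here refl) → subst (v ∈_) (sym split) (∈-++⁺ˡ v∈orbit)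
                   ; (there x∈) → subst (_ ∈_) (sym split) (∈-++⁺ʳ (orbit w k) (covers x∈)) } }
      where
      w = π^ j v
      P : Period w k
      P = period-shift j (proj₂ (period v))
      split : concat (ps ++ paths) ≡ orbit w k ++ concat paths
      split = trans (sym (concat-++ ps paths)) (cong (_++ concat paths) e)
      disjoint : ∀ {x} → ¬ (x ∈ orbit w k × x ∈ concat paths)
      disjoint (x∈ , x∈′) with i , _ , refl ← ∈-applyUpTo⁻ (λ i → π^ i w) {n = k} x∈ =
        v∉ (closed-π^ closed j (closed-π^ closed i x∈′))
      closed′ : ∀ {x} → x ∈ orbit w k ⊎ x ∈ concat paths → π⁻ x ∈ orbit w k ++ concat paths
      closed′ (inj₁ x∈) = ∈-++⁺ˡ (orbit-π⁻ P x∈)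
      closed′ (inj₂ x∈) = ∈-++⁺ʳ (orbit w k) (closed x∈)
      v∈orbit : v ∈ orbit w k
      -- The orbit is listed from `w`, which lies `j` steps after `v`; it is closed under `π⁻`, so
      -- it reaches back to `v`.
      v∈orbit = closed-π^ (orbit-π⁻ P) j (∈-applyUpTo⁺ (λ i → π^ i w) (Period.positive P))

  length-bound : ∀ {ps} → All Good ps → 3 * length ps ≤ length (concat ps)
  length-bound [] = z≤n
  length-bound {p ∷ ps} ((_ , 3≤) ∷ ok) = begin
    3 * suc (length ps)            ≡⟨ ℕ.*-suc 3 (length ps) ⟩
    3 + 3 * length ps              ≤⟨ ℕ.+-mono-≤ 3≤ (length-bound ok) ⟩
    length p + length (concat ps)  ≡⟨ length-++ p ⟨
    length (p ++ concat ps)        ∎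
    where open ℕ.≤-Reasoning

  decomposition : Σ (List (List V)) λ ps → IsIPD G ps × 3 * length ps ≤ n
  decomposition = paths , (All.map (λ (i , l) → i , ℕ.≤-trans (ℕ.n≤1+n 2) l) good , perm) ,
      ℕ.≤-trans (length-bound good) (ℕ.≤-reflexive (trans (↭-length perm) (length-tabulate id)))
    where
    open Partial (partial (allFin n))
    perm : concat paths ↭ allFin n
    perm = ∼bag⇒↭ (unique∧set⇒bag unique (Unique.allFin⁺ n)
      (mk⇔ (λ _ → ∈-allFin _) (λ v∈ → covers v∈)))

theorem6 : (n : ℕ) (G : Graph n) → Connected G → Bipartite G → Cubic G →
    Σ (List (List (Fin n))) λ ps → IsIPD G ps × 3 * length ps ≤ n
theorem6 n G _ (c , bip) cubic = Decomposition.decomposition G cubic c bip (TwoFactor.traversal G cubic c bip)
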